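{- Let $q\in\mathbb{C}$ with $|q|<1$, let $b\in\mathbb{C}$, and let $m$ be a non-negative integer. Let $D_q$ act on functions of the variable $x$. Then \[ \mathrm{H}_{n}(bD_{q})\{x^m\}= \begin{cases} x^m, & \text{if } n=0;\\[2pt] \Phi_{m}^{(q^n)}(b,x|q)=\displaystyle\sum_{k=0}^{m}\genfrac{[}{]}{0pt}{}{m}{k}_{q}(q^n;q)_{k}\,b^kx^{m-k}, & \text{if } n \text{ is an integer with } n\geq 1;\\[6pt] \mathrm{r}_{m}(b,x|q), & \text{if } n=\infty . \end{cases} \]
   Context: For $a\in\mathbb{C}$ and integers $n\ge 0$, $(a;q)_n=\prod_{k=0}^{n-1}(1-q^k a)$. The $q$-binomial coefficient is $\genfrac{[}{]}{0pt}{}{n}{k}_q=\frac{(q;q)_n}{(q;q)_k(q;q)_{n-k}}$. The $q$-differential operator is $D_q f(x)=\frac{f(x)-f(qx)}{x}$ (at $x=0$ the value is understood as the limit), and $D_q^k$ is its $k$-fold iterate, with $D_q^0$ the identity. For an integer $n\ge 0$, the $n$-th Heine binomial operator is \[ \mathrm{H}_n(bD_q)=\sum_{k=0}^{\infty}\frac{(q^n;q)_k}{(q;q)_k}(bD_q)^k,\qquad \mathrm{H}_n(bD_q)\{f(x)\}=\sum_{k=0}^\infty \frac{(q^n;q)_k}{(q;q)_k}b^kD_q^k f(x). \] For $n=\infty$, $\mathrm{H}_\infty(bD_q)$ denotes the limit operator, $\mathrm{H}_\infty(bD_q)\{f(x)\}=\lim_{n\to\infty}\mathrm{H}_n(bD_q)\{f(x)\}$.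 The homogeneous Hahn polynomials are $\Phi_{m}^{(\alpha)}(x,y|q)=\sum_{k=0}^{m}\genfrac{[}{]}{0pt}{}{m}{k}_{q}(\alpha;q)_{k}x^ky^{m-k}$, and $\mathrm{r}_m(b,x|q)=\sum_{k=0}^{m}\genfrac{[}{]}{0pt}{}{m}{k}_{q}b^kx^{m-k}$. -}

module Defs where

open import Algebra.Bundles using (CommutativeRing)
import Algebra.Properties.Semiring.Exp as SemiringExp
import Algebra.Properties.Semiring.Sum as SemiringSum
open import Data.Fin.Base using (toℕ)
open import Data.Nat.Base as ℕ using (ℕ; zero; suc; _∸_)
import Data.Nat.Properties as ℕₚ
open import Data.Product.Base using (∃; _×_; _,_; proj₁; proj₂)
import Data.Rational.Base
open import Data.Rational.Base as ℚ using (ℚ; 0ℚ; 1ℚ; ½)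
import Data.Rational.Properties as ℚₚ
open import Data.Sum.Base using (inj₁; inj₂)
open import Function.Bundles using (Func; _⟨$⟩_)
open import Level using (0ℓ)
open import Relation.Binary.PropositionalEquality as ≡ using (_≡_)
open import Relation.Nullary.Decidable.Core using (dec⇒maybe)
import Tactic.RingSolver as RingSolver
import Tactic.RingSolver.Core.AlmostCommutativeRing as ACR

-- Real numbers as Cauchy sequences of rationals; since ∃ carries a witness, every
-- real comes with a modulus of convergence.

module Real where

  infix 4 _≈_ _<_

  IsCauchy : (ℕ → ℚ) → Set
  IsCauchy s = ∀ ε → 0ℚ ℚ.< ε →
    ∃ λ N → ∀ m n → N ℕ.≤ m → N ℕ.≤ n → ℚ.∣ s m ℚ.- s n ∣ ℚ.≤ ε

  record ℝ : Set where
    constructor mkℝ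
    field
      seq    : ℕ → ℚ
      cauchy : IsCauchy seq

  open ℝ public

  record _≈_ (x y : ℝ) : Set where
    constructor mk≈
    field
      close : ∀ ε → 0ℚ ℚ.< ε →
        ∃ λ N → ∀ n → N ℕ.≤ n → ℚ.∣ seq x n ℚ.- seq y n ∣ ℚ.≤ ε

  open _≈_ public

  record _<_ (x y : ℝ) : Set where
    constructor mk<
    field
      gap     : ℚ
      gap-pos : 0ℚ ℚ.< gap
      from    : ℕ
      gap-≤   : ∀ n → from ℕ.≤ n → gap ℚ.≤ seq y n ℚ.- seq x n

  open _<_ public

  ℚ-solver : ACR.AlmostCommutativeRing 0ℓ 0ℓ
  ℚ-solver = ACR.fromCommutativeRing ℚₚ.+-*-commutativeRing (λ p → dec⇒maybe (0ℚ ℚₚ.≟ p))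

  open Data.Rational.Base using (_+_; _*_; _-_; -_; ∣_∣; _≤_; 1/_; Positive; NonNegative)

  module Rational where
    abstract
      split : ∀ a b c → a - c ≡ (a - b) + (b - c)
      split = RingSolver.solve-∀ ℚ-solver

      halves : ∀ ε → ½ * ε + ½ * ε ≡ ε
      halves ε = ≡.trans (≡.sym (ℚₚ.*-distribʳ-+ ε ½ ½)) (ℚₚ.*-identityˡ ε)

      half-pos : ∀ {ε} → 0ℚ ℚ.< ε → 0ℚ ℚ.< ½ * ε
      half-pos {ε} p = ℚₚ.positive⁻¹ (½ * ε) {{ℚₚ.pos*pos⇒pos ½ ε {{ℚ.positive p}}}}

      triangle : ∀ a b c → ∣ a - c ∣ ≤ ∣ a - b ∣ + ∣ b - c ∣
      triangle a b c =
        ≡.subst (λ t → ∣ t ∣ ≤ ∣ a - b ∣ + ∣ b - c ∣) (≡.sym (split a b c)) (ℚₚ.∣p+q∣≤∣p∣+∣q∣ (a - b) (b - c))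

      ∣-∣-swap : ∀ a b → ∣ a - b ∣ ≡ ∣ b - a ∣
      ∣-∣-swap a b = ≡.trans (≡.cong ∣_∣ (flip a b)) (ℚₚ.∣-p∣≡∣p∣ (b - a))
        where
        flip : ∀ a b → a - b ≡ - (b - a)
        flip = RingSolver.solve-∀ ℚ-solver

      ∣0∣≤ : ∀ a {ε} → 0ℚ ℚ.< ε → ∣ a - a ∣ ≤ ε
      ∣0∣≤ a {ε} p = ≡.subst (λ t → ∣ t ∣ ≤ ε) (≡.sym (ℚₚ.+-inverseʳ a)) (ℚₚ.<⇒≤ p)

      0≤a*b : ∀ {a b} → 0ℚ ≤ a → 0ℚ ≤ b → 0ℚ ≤ a * b
      0≤a*b {a} {b} p r = ℚₚ.nonNegative⁻¹ (a * b)
        {{ℚₚ.nonNeg*nonNeg⇒nonNeg a {{ℚ.nonNegative p}} b {{ℚ.nonNegative r}}}}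

      0<a*b : ∀ {a b} → 0ℚ ℚ.< a → 0ℚ ℚ.< b → 0ℚ ℚ.< a * b
      0<a*b {a} {b} p r = ℚₚ.positive⁻¹ (a * b)
        {{ℚₚ.pos*pos⇒pos a {{ℚ.positive p}} b {{ℚ.positive r}}}}

      *-mono-≤ : ∀ {a b c d} → 0ℚ ≤ c → 0ℚ ≤ b → a ≤ b → c ≤ d → a * c ≤ b * d
      *-mono-≤ {a} {b} {c} {d} 0≤c 0≤b a≤b c≤d = ℚₚ.≤-trans
        (ℚₚ.*-monoʳ-≤-nonNeg c {{ℚ.nonNegative 0≤c}} a≤b)
        (ℚₚ.*-monoˡ-≤-nonNeg b {{ℚ.nonNegative 0≤b}} c≤d)

      0≤a² : ∀ a → 0ℚ ≤ a * a
      0≤a² a with ℚₚ.≤-total 0ℚ a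
      ... | inj₁ p = 0≤a*b p p
      ... | inj₂ p = ≡.subst (0ℚ ≤_) (neg² a) (0≤a*b (ℚₚ.neg-antimono-≤ p) (ℚₚ.neg-antimono-≤ p))
        where
        neg² : ∀ a → (- a) * (- a) ≡ a * a
        neg² = RingSolver.solve-∀ ℚ-solver

      -- For every ε the tolerance ε′ with K ε′ = ε.
      shrink : ∀ {K} → 0ℚ ℚ.< K → ∀ {ε} → 0ℚ ℚ.< ε →
        ∃ λ ε′ → 0ℚ ℚ.< ε′ × K * ε′ ≡ ε
      shrink {K} 0<K {ε} 0<ε = ε * r , 0<a*b 0<ε 0<r , eq
        where
        instance
          K-pos : Positive K
          K-pos = ℚ.positive 0<K
          K≢0 : ℚ.NonZero K
          K≢0 = ℚₚ.pos⇒nonZero K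
        r : ℚ
        r = 1/ K
        0<r : 0ℚ ℚ.< r
        0<r = ℚₚ.positive⁻¹ r {{ℚₚ.1/pos⇒pos K}}
        rearrange : ∀ k e i → k * (e * i) ≡ (k * i) * e
        rearrange = RingSolver.solve-∀ ℚ-solver
        eq : K * (ε * r) ≡ ε
        eq = ≡.trans (rearrange K ε r)
               (≡.trans (≡.cong (_* ε) (ℚₚ.*-inverseʳ K)) (ℚₚ.*-identityˡ ε))

      m⊔n≤o⇒m≤o : ∀ {m n o} → m ℕ.⊔ n ℕ.≤ o → m ℕ.≤ o
      m⊔n≤o⇒m≤o {m} {n} = ℕₚ.m⊔n≤o⇒m≤o m n

      m⊔n≤o⇒n≤o : ∀ {m n o} → m ℕ.⊔ n ℕ.≤ o → n ℕ.≤ o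
      m⊔n≤o⇒n≤o {m} {n} = ℕₚ.m⊔n≤o⇒n≤o m n

  open Rational

  abstract
    ≈-refl : ∀ {x} → x ≈ x
    ≈-refl {x} = mk≈ λ ε p → 0 , λ n _ → ∣0∣≤ (seq x n) p

    ≈-pointwise : ∀ {x y} → (∀ n → seq x n ≡ seq y n) → x ≈ y
    ≈-pointwise {x} {y} e = mk≈ λ ε p → 0 , λ n _ →
      ≡.subst (λ t → ∣ seq x n - t ∣ ≤ ε) (e n) (∣0∣≤ (seq x n) p)

    ≈-sym : ∀ {x y} → x ≈ y → y ≈ x
    ≈-sym {x} {y} e = mk≈ λ ε p → let N , h = close e ε p in
      N , λ n N≤n → ≡.subst (_≤ ε) (∣-∣-swap (seq x n) (seq y n)) (h n N≤n)

    ≈-trans : ∀ {x y z} → x ≈ y → y ≈ z → x ≈ z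
    ≈-trans {x} {y} {z} d e = mk≈ λ ε p →
      let M , f = close d (½ * ε) (half-pos p)
          N , g = close e (½ * ε) (half-pos p)
      in M ℕ.⊔ N , λ n le → ℚₚ.≤-trans (triangle (seq x n) (seq y n) (seq z n))
           (≡.subst (_ ≤_) (halves ε)
             (ℚₚ.+-mono-≤ (f n (m⊔n≤o⇒m≤o le)) (g n (m⊔n≤o⇒n≤o {M} le))))

  private
    abstract
      const-cauchy : ∀ p → IsCauchy (λ _ → p)
      const-cauchy p ε 0<ε = 0 , λ _ _ _ _ → ∣0∣≤ p 0<ε

      ∣+-+∣ : ∀ a b c d → ∣ (a + b) - (c + d) ∣ ≤ ∣ a - c ∣ + ∣ b - d ∣
      ∣+-+∣ a b c d = ≡.subst (λ t → ∣ t ∣ ≤ ∣ a - c ∣ + ∣ b - d ∣) (≡.sym (regroup a b c d))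
                        (ℚₚ.∣p+q∣≤∣p∣+∣q∣ (a - c) (b - d))
        where
        regroup : ∀ a b c d → (a + b) - (c + d) ≡ (a - c) + (b - d)
        regroup = RingSolver.solve-∀ ℚ-solver

      ∣neg-neg∣ : ∀ a b → ∣ - a - - b ∣ ≡ ∣ a - b ∣
      ∣neg-neg∣ a b = ≡.trans (≡.cong ∣_∣ (swap a b)) (∣-∣-swap b a)
        where
        swap : ∀ a b → - a - - b ≡ b - a
        swap = RingSolver.solve-∀ ℚ-solver

      ∣*-*∣ : ∀ {A B ε} a b c d → 0ℚ ≤ A → 0ℚ ≤ B → ∣ a ∣ ≤ A → ∣ d ∣ ≤ B →
        ∣ b - d ∣ ≤ ε → ∣ a - c ∣ ≤ ε → ∣ a * b - c * d ∣ ≤ (A + B) * ε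
      ∣*-*∣ {A} {B} {ε} a b c d 0≤A 0≤B a≤A d≤B bd ac = ℚₚ.≤-trans
        (≡.subst (λ t → ∣ t ∣ ≤ ∣ a * (b - d) ∣ + ∣ d * (a - c) ∣) (≡.sym (regroup a b c d))
          (ℚₚ.∣p+q∣≤∣p∣+∣q∣ (a * (b - d)) (d * (a - c))))
        (≡.subst (_ ≤_) (≡.sym (ℚₚ.*-distribʳ-+ ε A B)) (ℚₚ.+-mono-≤
          (≡.subst (_≤ A * ε) (≡.sym (ℚₚ.∣p*q∣≡∣p∣*∣q∣ a (b - d)))
            (*-mono-≤ (ℚₚ.0≤∣p∣ (b - d)) 0≤A a≤A bd))
          (≡.subst (_≤ B * ε) (≡.sym (ℚₚ.∣p*q∣≡∣p∣*∣q∣ d (a - c)))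
            (*-mono-≤ (ℚₚ.0≤∣p∣ (a - c)) 0≤B d≤B ac))))
        where
        regroup : ∀ a b c d → a * b - c * d ≡ a * (b - d) + d * (a - c)
        regroup = RingSolver.solve-∀ ℚ-solver

  abstract
    eventually-bounded : ∀ x →
      ∃ λ B → 0ℚ ℚ.< B × ∃ λ N → ∀ n → N ℕ.≤ n → ∣ seq x n ∣ ≤ B
    eventually-bounded x =
      let N , h = cauchy x 1ℚ (ℚₚ.positive⁻¹ 1ℚ)
          s     = seq x N
          split₀ : ∀ a b → a ≡ (a - b) + b
          split₀ = RingSolver.solve-∀ ℚ-solver
      in 1ℚ + ∣ s ∣
       , ℚₚ.positive⁻¹ (1ℚ + ∣ s ∣)
           {{ℚₚ.pos+nonNeg⇒pos 1ℚ ∣ s ∣ {{ℚₚ.∣-∣-nonNeg s}}}}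
       , N , λ n N≤n → ℚₚ.≤-trans
           (≡.subst (λ t → ∣ t ∣ ≤ ∣ seq x n - s ∣ + ∣ s ∣) (≡.sym (split₀ (seq x n) s))
             (ℚₚ.∣p+q∣≤∣p∣+∣q∣ (seq x n - s) s))
           (ℚₚ.+-monoˡ-≤ ∣ s ∣ (h n N N≤n ℕₚ.≤-refl))

  private
    abstract
      +-cauchy : ∀ x y → IsCauchy (λ n → seq x n + seq y n)
      +-cauchy x y ε p =
        let M , f = cauchy x (½ * ε) (half-pos p)
            N , g = cauchy y (½ * ε) (half-pos p)
        in M ℕ.⊔ N , λ i j le le′ →
             ℚₚ.≤-trans (∣+-+∣ (seq x i) (seq y i) (seq x j) (seq y j))
               (≡.subst (_ ≤_) (halves ε) (ℚₚ.+-mono-≤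
                 (f i j (m⊔n≤o⇒m≤o le) (m⊔n≤o⇒m≤o le′))
                 (g i j (m⊔n≤o⇒n≤o {M} le) (m⊔n≤o⇒n≤o {M} le′))))

      neg-cauchy : ∀ x → IsCauchy (λ n → - seq x n)
      neg-cauchy x ε p = let N , f = cauchy x ε p in
        N , λ i j le le′ → ≡.subst (_≤ ε) (≡.sym (∣neg-neg∣ (seq x i) (seq x j))) (f i j le le′)

      *-cauchy : ∀ x y → IsCauchy (λ n → seq x n * seq y n)
      *-cauchy x y ε p =
        let A , 0<A , K , a = eventually-bounded x
            B , 0<B , L , b = eventually-bounded y
            δ , 0<δ , eq    = shrink (ℚₚ.+-mono-< 0<A 0<B) p
            M , f = cauchy x δ 0<δ
            N , g = cauchy y δ 0<δ
        in (K ℕ.⊔ L) ℕ.⊔ (M ℕ.⊔ N) , λ i j le le′ →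
             let KL = m⊔n≤o⇒m≤o le ; KL′ = m⊔n≤o⇒m≤o le′
                 MN = m⊔n≤o⇒n≤o {K ℕ.⊔ L} le ; MN′ = m⊔n≤o⇒n≤o {K ℕ.⊔ L} le′
             in ≡.subst (_ ≤_) eq (∣*-*∣ (seq x i) (seq y i) (seq x j) (seq y j)
                  (ℚₚ.<⇒≤ 0<A) (ℚₚ.<⇒≤ 0<B)
                  (a i (m⊔n≤o⇒m≤o KL)) (b j (m⊔n≤o⇒n≤o {K} KL′))
                  (g i j (m⊔n≤o⇒n≤o {M} MN) (m⊔n≤o⇒n≤o {M} MN′))
                  (f i j (m⊔n≤o⇒m≤o MN) (m⊔n≤o⇒m≤o MN′)))

  fromℚ : ℚ → ℝ
  fromℚ p = mkℝ (λ _ → p) (const-cauchy p)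

  0ℝ 1ℝ : ℝ
  0ℝ = fromℚ 0ℚ
  1ℝ = fromℚ 1ℚ

  add mul : ℝ → ℝ → ℝ
  add x y = mkℝ (λ n → seq x n + seq y n) (+-cauchy x y)
  mul x y = mkℝ (λ n → seq x n * seq y n) (*-cauchy x y)

  neg : ℝ → ℝ
  neg x = mkℝ (λ n → - seq x n) (neg-cauchy x)

  abstract
    add-cong : ∀ {x y u v} → x ≈ y → u ≈ v → add x u ≈ add y v
    add-cong {x} {y} {u} {v} d e = mk≈ λ ε p →
      let M , f = close d (½ * ε) (half-pos p)
          N , g = close e (½ * ε) (half-pos p)
      in M ℕ.⊔ N , λ i le →
           ℚₚ.≤-trans (∣+-+∣ (seq x i) (seq u i) (seq y i) (seq v i))
             (≡.subst (_ ≤_) (halves ε) (ℚₚ.+-mono-≤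
               (f i (m⊔n≤o⇒m≤o le)) (g i (m⊔n≤o⇒n≤o {M} le))))

    neg-cong : ∀ {x y} → x ≈ y → neg x ≈ neg y
    neg-cong {x} {y} e = mk≈ λ ε p → let N , f = close e ε p in
      N , λ i le → ≡.subst (_≤ ε) (≡.sym (∣neg-neg∣ (seq x i) (seq y i))) (f i le)

    mul-cong : ∀ {x y u v} → x ≈ y → u ≈ v → mul x u ≈ mul y v
    mul-cong {x} {y} {u} {v} d e = mk≈ λ ε p →
      let A , 0<A , K , a = eventually-bounded x
          B , 0<B , L , b = eventually-bounded v
          δ , 0<δ , eq    = shrink (ℚₚ.+-mono-< 0<A 0<B) p
          M , f = close d δ 0<δ
          N , g = close e δ 0<δ
      in (K ℕ.⊔ L) ℕ.⊔ (M ℕ.⊔ N) , λ i le →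
           let KL = m⊔n≤o⇒m≤o le
               MN = m⊔n≤o⇒n≤o {K ℕ.⊔ L} le
           in ≡.subst (_ ≤_) eq (∣*-*∣ (seq x i) (seq u i) (seq y i) (seq v i)
                (ℚₚ.<⇒≤ 0<A) (ℚₚ.<⇒≤ 0<B)
                (a i (m⊔n≤o⇒m≤o KL)) (b i (m⊔n≤o⇒n≤o {K} KL))
                (g i (m⊔n≤o⇒n≤o {M} MN)) (f i (m⊔n≤o⇒m≤o MN)))

  commutativeRing : CommutativeRing 0ℓ 0ℓ
  commutativeRing = record
    { Carrier = ℝ ; _≈_ = _≈_ ; _+_ = add ; _*_ = mul ; -_ = neg ; 0# = 0ℝ ; 1# = 1ℝ
    ; isCommutativeRing = record
      { isRing = record
        { +-isAbelianGroup = record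
          { isGroup = record
            { isMonoid = record
              { isSemigroup = record
                { isMagma = record
                  { isEquivalence = record { refl = ≈-refl ; sym = ≈-sym ; trans = ≈-trans }
                  ; ∙-cong = add-cong
                  }
                ; assoc = λ x y z → ≈-pointwise λ n → ℚₚ.+-assoc (seq x n) (seq y n) (seq z n)
                }
              ; identity = (λ x → ≈-pointwise λ n → ℚₚ.+-identityˡ (seq x n))
                         , (λ x → ≈-pointwise λ n → ℚₚ.+-identityʳ (seq x n))
              }
            ; inverse = (λ x → ≈-pointwise λ n → ℚₚ.+-inverseˡ (seq x n))
                      , (λ x → ≈-pointwise λ n → ℚₚ.+-inverseʳ (seq x n))
            ; ⁻¹-cong = neg-cong
            }
          ; comm = λ x y → ≈-pointwise λ n → ℚₚ.+-comm (seq x n) (seq y n)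
          }
        ; *-cong = mul-cong
        ; *-assoc = λ x y z → ≈-pointwise λ n → ℚₚ.*-assoc (seq x n) (seq y n) (seq z n)
        ; *-identity = (λ x → ≈-pointwise λ n → ℚₚ.*-identityˡ (seq x n))
                     , (λ x → ≈-pointwise λ n → ℚₚ.*-identityʳ (seq x n))
        ; distrib = (λ x y z → ≈-pointwise λ n → ℚₚ.*-distribˡ-+ (seq x n) (seq y n) (seq z n))
                  , (λ x y z → ≈-pointwise λ n → ℚₚ.*-distribʳ-+ (seq x n) (seq y n) (seq z n))
        }
      ; *-comm = λ x y → ≈-pointwise λ n → ℚₚ.*-comm (seq x n) (seq y n)
      }
    }

  -- Inverse of a positive real: the sequence is shifted to a range where it
  -- stays above a positive rational.

  private
    abstract
      drop-0 : ∀ a → a - 0ℚ ≡ a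
      drop-0 = RingSolver.solve-∀ ℚ-solver

    module Inverse {x : ℝ} (0<x : 0ℝ < x) where

      tail : ℕ → ℚ
      tail n = seq x (from 0<x ℕ.+ n)

      abstract
        gap≤tail : ∀ n → gap 0<x ≤ tail n
        gap≤tail n = ≡.subst (gap 0<x ≤_) (drop-0 (tail n))
          (gap-≤ 0<x (from 0<x ℕ.+ n) (ℕₚ.m≤m+n (from 0<x) n))

        tail-pos : ∀ n → 0ℚ ℚ.< tail n
        tail-pos n = ℚₚ.<-≤-trans (gap-pos 0<x) (gap≤tail n)

      tail-nonZero : ∀ n → ℚ.NonZero (tail n)
      tail-nonZero n = ℚ.>-nonZero (tail-pos n)

      inverse : ℕ → ℚ
      inverse n = (1/ tail n) {{tail-nonZero n}}

      abstract
        inverseˡ : ∀ n → inverse n * tail n ≡ 1ℚ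
        inverseˡ n = ℚₚ.*-inverseˡ (tail n) {{tail-nonZero n}}

        inverse-pos : ∀ n → 0ℚ ℚ.< inverse n
        inverse-pos n = ℚₚ.positive⁻¹ (inverse n)
          {{ℚₚ.1/pos⇒pos (tail n) {{ℚ.positive (tail-pos n)}}}}

        -- 1/a ≤ K as soon as K · gap = 1.
        inverse-≤ : ∀ {K} → 0ℚ ℚ.< K → gap 0<x * K ≡ 1ℚ → ∀ n → inverse n ≤ K
        inverse-≤ {K} 0<K eq n = ≡.subst₂ _≤_ lhs rhs
          (ℚₚ.*-monoʳ-≤-nonNeg (inverse n * K)
            {{ℚ.nonNegative (ℚₚ.<⇒≤ (0<a*b (inverse-pos n) 0<K))}} (gap≤tail n))
          where
          swap₁ : ∀ g i k → g * (i * k) ≡ (g * k) * i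
          swap₁ = RingSolver.solve-∀ ℚ-solver
          swap₂ : ∀ t i k → t * (i * k) ≡ (i * t) * k
          swap₂ = RingSolver.solve-∀ ℚ-solver
          lhs : gap 0<x * (inverse n * K) ≡ inverse n
          lhs = ≡.trans (swap₁ (gap 0<x) (inverse n) K)
                  (≡.trans (≡.cong (_* inverse n) eq) (ℚₚ.*-identityˡ (inverse n)))
          rhs : tail n * (inverse n * K) ≡ K
          rhs = ≡.trans (swap₂ (tail n) (inverse n) K)
                  (≡.trans (≡.cong (_* K) (inverseˡ n)) (ℚₚ.*-identityˡ K))

        difference : ∀ i j →
          inverse i - inverse j ≡ (inverse i * inverse j) * (tail j - tail i)
        difference i j = ≡.sym (≡.trans (expand (inverse i) (inverse j) (tail i) (tail j))
          (≡.trans (≡.cong₂ (λ s t → inverse i * s - inverse j * t) (inverseˡ j) (inverseˡ i))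
            (≡.cong₂ _-_ (ℚₚ.*-identityʳ (inverse i)) (ℚₚ.*-identityʳ (inverse j)))))
          where
          expand : ∀ u v s t → (u * v) * (t - s) ≡ u * (v * t) - v * (u * s)
          expand = RingSolver.solve-∀ ℚ-solver

        inverse-cauchy : IsCauchy inverse
        inverse-cauchy ε p =
          let K , 0<K , eq = shrink (gap-pos 0<x) (ℚₚ.positive⁻¹ 1ℚ)
              δ , 0<δ , eq′ = shrink (0<a*b 0<K 0<K) p
              N , f = cauchy x δ 0<δ
              bound = inverse-≤ 0<K eq
          in N , λ i j le le′ →
            let w = inverse i * inverse j
                0≤w = ℚₚ.<⇒≤ (0<a*b (inverse-pos i) (inverse-pos j))
                w≤ : ∣ w ∣ ≤ K * K
                w≤ = ≡.subst (_≤ K * K) (≡.sym (ℚₚ.0≤p⇒∣p∣≡p 0≤w))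
                       (*-mono-≤ (ℚₚ.<⇒≤ (inverse-pos j)) (ℚₚ.<⇒≤ 0<K) (bound i) (bound j))
            in ≡.subst₂ _≤_
                 (≡.sym (≡.trans (≡.cong ∣_∣ (difference i j)) (ℚₚ.∣p*q∣≡∣p∣*∣q∣ w (tail j - tail i))))
                 eq′
                 (*-mono-≤ (ℚₚ.0≤∣p∣ (tail j - tail i)) (ℚₚ.<⇒≤ (0<a*b 0<K 0<K)) w≤
                   (f (from 0<x ℕ.+ j) (from 0<x ℕ.+ i)
                     (ℕₚ.≤-trans le′ (ℕₚ.m≤n+m j (from 0<x)))
                     (ℕₚ.≤-trans le (ℕₚ.m≤n+m i (from 0<x)))))

        inverse-x : ∀ {ε} → 0ℚ ℚ.< ε →
          ∃ λ N → ∀ n → N ℕ.≤ n → ∣ inverse n * seq x n - 1ℚ ∣ ≤ ε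
        inverse-x p =
          let K , 0<K , eq = shrink (gap-pos 0<x) (ℚₚ.positive⁻¹ 1ℚ)
              δ , 0<δ , eq′ = shrink 0<K p
              N , f = cauchy x δ 0<δ
          in N , λ n le → ≡.subst₂ _≤_
               (≡.sym (≡.trans (≡.cong ∣_∣ (rewrite₁ n)) (ℚₚ.∣p*q∣≡∣p∣*∣q∣ (inverse n) (seq x n - tail n))))
               eq′
               (*-mono-≤ (ℚₚ.0≤∣p∣ (seq x n - tail n)) (ℚₚ.<⇒≤ 0<K)
                 (≡.subst (_≤ K) (≡.sym (ℚₚ.0≤p⇒∣p∣≡p (ℚₚ.<⇒≤ (inverse-pos n)))) (inverse-≤ 0<K eq n))
                 (f n (from 0<x ℕ.+ n) le (ℕₚ.≤-trans le (ℕₚ.m≤n+m n (from 0<x)))))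
          where
          expand : ∀ i s t → i * s - i * t ≡ i * (s - t)
          expand = RingSolver.solve-∀ ℚ-solver
          rewrite₁ : ∀ n → inverse n * seq x n - 1ℚ ≡ inverse n * (seq x n - tail n)
          rewrite₁ n = ≡.trans (≡.cong (λ t → inverse n * seq x n - t) (≡.sym (inverseˡ n)))
                         (expand (inverse n) (seq x n) (tail n))

  inv : (x : ℝ) → 0ℝ < x → ℝ
  inv x 0<x = mkℝ (Inverse.inverse 0<x) (Inverse.inverse-cauchy 0<x)

  abstract
    inv-inverseˡ : ∀ x (0<x : 0ℝ < x) → mul (inv x 0<x) x ≈ 1ℝ
    inv-inverseˡ x 0<x = mk≈ λ ε p → Inverse.inverse-x 0<x p

  abstract
    <-respʳ-≈ : ∀ {x y z} → y ≈ z → x < y → x < z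
    <-respʳ-≈ {x} {y} {z} e l =
      let N , f = close e (½ * gap l) (half-pos (gap-pos l)) in
      mk< (½ * gap l) (half-pos (gap-pos l)) (from l ℕ.⊔ N) λ n le →
        let h = ½ * gap l
            p : h + h ≤ seq y n - seq x n
            p = ≡.subst (_≤ seq y n - seq x n) (≡.sym (halves (gap l))) (gap-≤ l n (m⊔n≤o⇒m≤o le))
            r : seq y n - seq z n ≤ h
            r = ℚₚ.≤-trans (p≤∣p∣ (seq y n - seq z n)) (f n (m⊔n≤o⇒n≤o {from l} le))
        in ≡.subst₂ _≤_ (cancel h) (regroup (seq x n) (seq y n) (seq z n))
             (ℚₚ.+-mono-≤ p (ℚₚ.neg-antimono-≤ r))
      where
      p≤∣p∣ : ∀ p → p ≤ ∣ p ∣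
      p≤∣p∣ p with ℚₚ.≤-total 0ℚ p
      ... | inj₁ 0≤p = ℚₚ.≤-reflexive (≡.sym (ℚₚ.0≤p⇒∣p∣≡p 0≤p))
      ... | inj₂ p≤0 = ℚₚ.≤-trans p≤0 (ℚₚ.0≤∣p∣ p)
      cancel : ∀ h → (h + h) + - h ≡ h
      cancel = RingSolver.solve-∀ ℚ-solver
      regroup : ∀ a b c → (b - a) + - (b - c) ≡ c - a
      regroup = RingSolver.solve-∀ ℚ-solver

    <-neg : ∀ {x y} → x < y → neg y < neg x
    <-neg {x} {y} l = mk< (gap l) (gap-pos l) (from l) λ n le →
      ≡.subst (gap l ≤_) (swap (seq x n) (seq y n)) (gap-≤ l n le)
      where
      swap : ∀ a b → b - a ≡ - a - - b
      swap = RingSolver.solve-∀ ℚ-solver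

    <-neg⁻¹ : ∀ {x y} → neg y < neg x → x < y
    <-neg⁻¹ {x} {y} l = mk< (gap l) (gap-pos l) (from l) λ n le →
      ≡.subst (gap l ≤_) (swap (seq x n) (seq y n)) (gap-≤ l n le)
      where
      swap : ∀ a b → - a - - b ≡ b - a
      swap = RingSolver.solve-∀ ℚ-solver

    <-respˡ-≈ : ∀ {x y z} → x ≈ y → x < z → y < z
    <-respˡ-≈ e l = <-neg⁻¹ (<-respʳ-≈ (neg-cong e) (<-neg l))

    0<1 : 0ℝ < 1ℝ
    0<1 = mk< 1ℚ (ℚₚ.positive⁻¹ 1ℚ) 0 λ _ _ → ℚₚ.≤-refl

    mul-pos : ∀ {x y} → 0ℝ < x → 0ℝ < y → 0ℝ < mul x y
    mul-pos {x} {y} p r =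
      mk< (gap p * gap r) (0<a*b (gap-pos p) (gap-pos r)) (from p ℕ.⊔ from r) λ n le →
        let a = ≡.subst (gap p ≤_) (drop-0 (seq x n)) (gap-≤ p n (m⊔n≤o⇒m≤o le))
            b = ≡.subst (gap r ≤_) (drop-0 (seq y n)) (gap-≤ r n (m⊔n≤o⇒n≤o {from p} le))
        in ≡.subst (gap p * gap r ≤_) (≡.sym (drop-0 (seq x n * seq y n)))
             (*-mono-≤ (ℚₚ.<⇒≤ (gap-pos r)) (ℚₚ.≤-trans (ℚₚ.<⇒≤ (gap-pos p)) a) a b)

    add-square-pos : ∀ {x} y → 0ℝ < x → 0ℝ < add x (mul y y)
    add-square-pos {x} y p = mk< (gap p) (gap-pos p) (from p) λ n le →
      ≡.subst₂ _≤_ (ℚₚ.+-identityʳ (gap p)) (regroup (seq x n) (seq y n * seq y n))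
        (ℚₚ.+-mono-≤ (gap-≤ p n le) (0≤a² (seq y n)))
      where
      regroup : ∀ a b → (a - 0ℚ) + b ≡ (a + b) - 0ℚ
      regroup = RingSolver.solve-∀ ℚ-solver

    -- 2 (1 - a) = (1 - a² - b²) + (1 - a)² + b²
    0<1-re : ∀ {a b} → add (mul a a) (mul b b) < 1ℝ → 0ℝ < add 1ℝ (neg a)
    0<1-re {a} {b} l = mk< (½ * gap l) (half-pos (gap-pos l)) (from l) λ n le →
      let s = seq a n ; t = seq b n in
      ≡.subst (½ * gap l ≤_) (double s)
        (ℚₚ.*-monoˡ-≤-nonNeg ½
          (≡.subst₂ _≤_ (drop₀₀ (gap l)) (collect s t)
            (ℚₚ.+-mono-≤ (ℚₚ.+-mono-≤ (gap-≤ l n le) (0≤a² (1ℚ - s))) (0≤a² t))))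
      where
      drop₀₀ : ∀ g → (g + 0ℚ) + 0ℚ ≡ g
      drop₀₀ g = ≡.trans (ℚₚ.+-identityʳ (g + 0ℚ)) (ℚₚ.+-identityʳ g)
      expand : ∀ o s t → ((o * o - (s * s + t * t)) + (o - s) * (o - s)) + t * t
                       ≡ o * ((o - s) + (o - s))
      expand = RingSolver.solve-∀ ℚ-solver
      collect : ∀ s t → ((1ℚ - (s * s + t * t)) + (1ℚ - s) * (1ℚ - s)) + t * t
                      ≡ (1ℚ - s) + (1ℚ - s)
      collect s t = ≡.trans (expand 1ℚ s t) (ℚₚ.*-identityˡ ((1ℚ - s) + (1ℚ - s)))
      double : ∀ s → ½ * ((1ℚ - s) + (1ℚ - s)) ≡ (1ℚ + - s) - 0ℚ
      double s = ≡.trans (ℚₚ.*-distribˡ-+ ½ (1ℚ - s) (1ℚ - s))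
        (≡.trans (halves (1ℚ - s)) (≡.sym (drop-0 (1ℚ - s))))

    -- 1 - uv = (1 - u) + u (1 - v)
    mul-<1 : ∀ {u v} → (∀ n → 0ℚ ≤ seq u n) → u < 1ℝ → v < 1ℝ → mul u v < 1ℝ
    mul-<1 {u} {v} 0≤u p r = mk< (gap p) (gap-pos p) (from p ℕ.⊔ from r) λ n le →
      ≡.subst₂ _≤_ (ℚₚ.+-identityʳ (gap p)) (collect (seq u n) (seq v n))
        (ℚₚ.+-mono-≤ (gap-≤ p n (m⊔n≤o⇒m≤o le))
          (0≤a*b (0≤u n) (ℚₚ.≤-trans (ℚₚ.<⇒≤ (gap-pos r)) (gap-≤ r n (m⊔n≤o⇒n≤o {from p} le)))))
      where
      expand : ∀ o s t → (o - s) + s * (o - t) ≡ (o - s) + (s * o - s * t)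
      expand = RingSolver.solve-∀ ℚ-solver
      merge : ∀ o s t → (o - s) + (s - t) ≡ o - t
      merge = RingSolver.solve-∀ ℚ-solver
      collect : ∀ s t → (1ℚ - s) + s * (1ℚ - t) ≡ 1ℚ - s * t
      collect s t = ≡.trans (expand 1ℚ s t)
        (≡.trans (≡.cong (λ r → (1ℚ - s) + (r - s * t)) (ℚₚ.*-identityʳ s))
                 (merge 1ℚ s (s * t)))

    sum-of-squares-nonNeg : ∀ a b n → 0ℚ ≤ seq (add (mul a a) (mul b b)) n
    sum-of-squares-nonNeg a b n =
      ≡.subst (_≤ seq a n * seq a n + seq b n * seq b n) (ℚₚ.+-identityʳ 0ℚ) (ℚₚ.+-mono-≤ (0≤a² (seq a n)) (0≤a² (seq b n)))

open Real public using (ℝ; 0ℝ; 1ℝ; _<_)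

record ℂ : Set where
  constructor _+i_
  field
    re im : ℝ

open ℂ public

module Complex where
  open Real hiding (_<_; ℝ; 0ℝ; 1ℝ; commutativeRing)
  open Rational

  record _≈ᶜ_ (z w : ℂ) : Set where
    constructor _,_
    field
      re-≈ : re z ≈ re w
      im-≈ : im z ≈ im w

  open _≈ᶜ_ public

  addᶜ mulᶜ : ℂ → ℂ → ℂ
  addᶜ (a +i b) (c +i d) = add a c +i add b d
  mulᶜ (a +i b) (c +i d) = add (mul a c) (neg (mul b d)) +i add (mul a d) (mul b c)

  negᶜ : ℂ → ℂ
  negᶜ (a +i b) = neg a +i neg b

  0ᶜ 1ᶜ : ℂ
  0ᶜ = 0ℝ +i 0ℝ
  1ᶜ = 1ℝ +i 0ℝ

  normSq : ℂ → ℝ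
  normSq (a +i b) = add (mul a a) (mul b b)

  private
    open Data.Rational.Base using (_+_; _*_; _-_; -_)

    abstract
      assoc-re : ∀ a b c d e f → (a * c + - (b * d)) * e + - ((a * d + b * c) * f)
                               ≡ a * (c * e + - (d * f)) + - (b * (c * f + d * e))
      assoc-re = RingSolver.solve-∀ ℚ-solver
      assoc-im : ∀ a b c d e f → (a * c + - (b * d)) * f + (a * d + b * c) * e
                               ≡ a * (c * f + d * e) + b * (c * e + - (d * f))
      assoc-im = RingSolver.solve-∀ ℚ-solver
      distribˡ-re : ∀ a b c d e f → a * (c + e) + - (b * (d + f))
                                  ≡ (a * c + - (b * d)) + (a * e + - (b * f))
      distribˡ-re = RingSolver.solve-∀ ℚ-solver
      distribˡ-im : ∀ a b c d e f → a * (d + f) + b * (c + e)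
                                  ≡ (a * d + b * c) + (a * f + b * e)
      distribˡ-im = RingSolver.solve-∀ ℚ-solver
      comm-re : ∀ a b c d → a * c + - (b * d) ≡ c * a + - (d * b)
      comm-re = RingSolver.solve-∀ ℚ-solver
      comm-im : ∀ a b c d → a * d + b * c ≡ c * b + d * a
      comm-im = RingSolver.solve-∀ ℚ-solver
      drop-zero-re : ∀ o b a → a * o + - (b * 0ℚ) ≡ o * a
      drop-zero-re = RingSolver.solve-∀ ℚ-solver
      drop-zero-im : ∀ o b a → a * 0ℚ + b * o ≡ o * b
      drop-zero-im = RingSolver.solve-∀ ℚ-solver
      norm-* : ∀ a b c d →
        (a * a + b * b) * (c * c + d * d)
          ≡ (a * c + - (b * d)) * (a * c + - (b * d)) + (a * d + b * c) * (a * d + b * c)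
      norm-* = RingSolver.solve-∀ ℚ-solver
      recip-re : ∀ i a b → (a * i) * a + - ((- b * i) * b) ≡ i * (a * a + b * b)
      recip-re = RingSolver.solve-∀ ℚ-solver
      recip-im : ∀ i a b → (a * i) * b + (- b * i) * a ≡ 0ℚ
      recip-im = RingSolver.solve-∀ ℚ-solver

  abstract
    mulᶜ-comm : ∀ z w → mulᶜ z w ≈ᶜ mulᶜ w z
    mulᶜ-comm (a +i b) (c +i d) =
        ≈-pointwise (λ n → comm-re (seq a n) (seq b n) (seq c n) (seq d n))
      , ≈-pointwise (λ n → comm-im (seq a n) (seq b n) (seq c n) (seq d n))

    ≈ᶜ-trans : ∀ {x y z} → x ≈ᶜ y → y ≈ᶜ z → x ≈ᶜ z
    ≈ᶜ-trans (p , p′) (r , r′) = ≈-trans p r , ≈-trans p′ r′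

    addᶜ-cong : ∀ {x y u v} → x ≈ᶜ y → u ≈ᶜ v → addᶜ x u ≈ᶜ addᶜ y v
    addᶜ-cong (p , p′) (r , r′) = add-cong p r , add-cong p′ r′

    mulᶜ-cong : ∀ {x y u v} → x ≈ᶜ y → u ≈ᶜ v → mulᶜ x u ≈ᶜ mulᶜ y v
    mulᶜ-cong (p , p′) (r , r′) =
        add-cong (mul-cong p r) (neg-cong (mul-cong p′ r′))
      , add-cong (mul-cong p r′) (mul-cong p′ r)

    mulᶜ-identityʳ : ∀ z → mulᶜ z 1ᶜ ≈ᶜ z
    mulᶜ-identityʳ (a +i b) =
        ≈-pointwise (λ n → ≡.trans (drop-zero-re 1ℚ (seq b n) (seq a n)) (ℚₚ.*-identityˡ (seq a n)))
      , ≈-pointwise (λ n → ≡.trans (drop-zero-im 1ℚ (seq b n) (seq a n)) (ℚₚ.*-identityˡ (seq b n)))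

    mulᶜ-distribˡ : ∀ z u v → mulᶜ z (addᶜ u v) ≈ᶜ addᶜ (mulᶜ z u) (mulᶜ z v)
    mulᶜ-distribˡ (a +i b) (c +i d) (e +i f) =
        ≈-pointwise (λ n → distribˡ-re (seq a n) (seq b n) (seq c n) (seq d n) (seq e n) (seq f n))
      , ≈-pointwise (λ n → distribˡ-im (seq a n) (seq b n) (seq c n) (seq d n) (seq e n) (seq f n))

    mulᶜ-assoc : ∀ u v w → mulᶜ (mulᶜ u v) w ≈ᶜ mulᶜ u (mulᶜ v w)
    mulᶜ-assoc (a +i b) (c +i d) (e +i f) =
        ≈-pointwise (λ n → assoc-re (seq a n) (seq b n) (seq c n) (seq d n) (seq e n) (seq f n))
      , ≈-pointwise (λ n → assoc-im (seq a n) (seq b n) (seq c n) (seq d n) (seq e n) (seq f n))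

    normSq-* : ∀ z w → mul (normSq z) (normSq w) ≈ normSq (mulᶜ z w)
    normSq-* (a +i b) (c +i d) =
      ≈-pointwise (λ n → norm-* (seq a n) (seq b n) (seq c n) (seq d n))

  commutativeRing : CommutativeRing 0ℓ 0ℓ
  commutativeRing = record
    { Carrier = ℂ ; _≈_ = _≈ᶜ_ ; _+_ = addᶜ ; _*_ = mulᶜ ; -_ = negᶜ ; 0# = 0ᶜ ; 1# = 1ᶜ
    ; isCommutativeRing = record
      { isRing = record
        { +-isAbelianGroup = record
          { isGroup = record
            { isMonoid = record
              { isSemigroup = record
                { isMagma = record
                  { isEquivalence = record
                    { refl  = ≈-refl , ≈-refl
                    ; sym   = λ (p , p′) → ≈-sym p , ≈-sym p′
                    ; trans = ≈ᶜ-trans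
                    }
                  ; ∙-cong = addᶜ-cong
                  }
                ; assoc = λ (a +i b) (c +i d) (e +i f) → R.+-assoc a c e , R.+-assoc b d f
                }
              ; identity = (λ (a +i b) → R.+-identityˡ a , R.+-identityˡ b)
                         , (λ (a +i b) → R.+-identityʳ a , R.+-identityʳ b)
              }
            ; inverse = (λ (a +i b) → R.-‿inverseˡ a , R.-‿inverseˡ b)
                      , (λ (a +i b) → R.-‿inverseʳ a , R.-‿inverseʳ b)
            ; ⁻¹-cong = λ (p , p′) → neg-cong p , neg-cong p′
            }
          ; comm = λ (a +i b) (c +i d) → R.+-comm a c , R.+-comm b d
          }
        ; *-cong = mulᶜ-cong
        ; *-assoc = mulᶜ-assoc
        ; *-identity = (λ z → ≈ᶜ-trans (mulᶜ-comm 1ᶜ z) (mulᶜ-identityʳ z)) , mulᶜ-identityʳ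
        ; distrib = mulᶜ-distribˡ
                  , (λ z u v → ≈ᶜ-trans (mulᶜ-comm (addᶜ u v) z) (≈ᶜ-trans (mulᶜ-distribˡ z u v)
                      (addᶜ-cong (mulᶜ-comm z u) (mulᶜ-comm z v))))
        }
      ; *-comm = mulᶜ-comm
      }
    }
    where module R = CommutativeRing Real.commutativeRing

  -- Constructively z ≠ 0 is the statement |z|² > 0, which is what division needs.
  Nonzero : ℂ → Set
  Nonzero z = 0ℝ < normSq z

  recip : (z : ℂ) → Nonzero z → ℂ
  recip z nz = mul (re z) i +i mul (neg (im z)) i
    where i = inv (normSq z) nz

  abstract
    recip-inverseˡ : ∀ z (nz : Nonzero z) → mulᶜ (recip z nz) z ≈ᶜ 1ᶜ
    recip-inverseˡ z@(a +i b) nz =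
        ≈-trans (≈-pointwise (λ n → recip-re (seq i n) (seq a n) (seq b n))) (inv-inverseˡ (normSq z) nz)
      , ≈-pointwise (λ n → recip-im (seq i n) (seq a n) (seq b n))
      where
      i : ℝ
      i = inv (normSq z) nz

  -- |z| < r, without taking the square root in |z|.
  ∣_∣<_ : ℂ → ℝ → Set
  ∣ z ∣< r = 0ℝ < r × normSq z < mul r r

  infix 4 ∣_∣<_

  abstract
    1-nonzero : Nonzero 1ᶜ
    1-nonzero = add-square-pos 0ℝ (mul-pos 0<1 0<1)

    *-nonzero : ∀ {z w} → Nonzero z → Nonzero w → Nonzero (mulᶜ z w)
    *-nonzero {z} {w} p r = <-respʳ-≈ (normSq-* z w) (mul-pos p r)

    1-z-nonzero : ∀ {z} → normSq z < 1ℝ → Nonzero (addᶜ 1ᶜ (negᶜ z))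
    1-z-nonzero {z} l = add-square-pos (add 0ℝ (neg (im z))) (mul-pos 0<1-a 0<1-a)
      where
      0<1-a : 0ℝ < add 1ℝ (neg (re z))
      0<1-a = 0<1-re {re z} {im z} l

    mod<1 : ∀ {z} → ∣ z ∣< 1ℝ → normSq z < 1ℝ
    mod<1 (_ , l) = <-respʳ-≈ (≈-pointwise (λ _ → ℚₚ.*-identityˡ 1ℚ)) l

    normSq-cong : ∀ {z w} → z ≈ᶜ w → normSq z ≈ normSq w
    normSq-cong (p , r) = add-cong (mul-cong p p) (mul-cong r r)

    normSq-*-<1 : ∀ {z w} → normSq z < 1ℝ → normSq w < 1ℝ → normSq (mulᶜ z w) < 1ℝ
    normSq-*-<1 {z} {w} p r =
      <-respˡ-≈ (normSq-* z w) (mul-<1 (sum-of-squares-nonNeg (re z) (im z)) p r)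

open Complex public using (Nonzero; normSq; ∣_∣<_)

open CommutativeRing Complex.commutativeRing public
  using (_≈_; _+_; _*_; _-_; -_; 0#; 1#; setoid)
open CommutativeRing Complex.commutativeRing using (semiring)
open SemiringExp semiring public using (_^_; ^-congˡ)
open SemiringSum semiring public using (sum; sum-syntax; sum⁺-syntax)

infixl 7 _/_[_]

_/_[_] : (z w : ℂ) → Nonzero w → ℂ
z / w [ nz ] = z * Complex.recip w nz

Converges : (ℕ → ℂ) → ℂ → Set
Converges u l = ∀ ε → 0ℝ < ε → ∃ λ N → ∀ n → N ℕ.≤ n → ∣ u n - l ∣< ε

HasSum : (ℕ → ℂ) → ℂ → Set
HasSum a s = Converges (λ n → ∑[ k < n ] a (toℕ k)) s

HasLimitAt0 : (∀ x → Nonzero x → ℂ) → ℂ → Set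
HasLimitAt0 φ l = ∀ ε → 0ℝ < ε → ∃ λ δ → 0ℝ < δ ×
  (∀ x (x≢0 : Nonzero x) → ∣ x ∣< δ → ∣ φ x x≢0 - l ∣< ε)

qPochhammer : (a q : ℂ) → ℕ → ℂ
qPochhammer a q zero    = 1#
qPochhammer a q (suc n) = qPochhammer a q n * (1# - q ^ n * a)

abstract
  qPochhammer-nonzero : ∀ q → ∣ q ∣< 1ℝ → ∀ n → Nonzero (qPochhammer q q n)
  qPochhammer-nonzero q ∣q∣<1 zero    = Complex.1-nonzero
  qPochhammer-nonzero q ∣q∣<1 (suc n) =
    Complex.*-nonzero {qPochhammer q q n} (qPochhammer-nonzero q ∣q∣<1 n)
      (Complex.1-z-nonzero {q ^ n * q} (power<1 n))
    where
    q<1 : normSq q < 1ℝ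
    q<1 = Complex.mod<1 {q} ∣q∣<1
    module C = CommutativeRing Complex.commutativeRing
    power<1 : ∀ n → normSq (q ^ n * q) < 1ℝ
    power<1 zero    = Real.<-respˡ-≈ (Complex.normSq-cong (C.sym (C.*-identityˡ q))) q<1
    power<1 (suc n) = Real.<-respˡ-≈ (Complex.normSq-cong (C.sym (C.*-assoc q (q ^ n) q)))
                        (Complex.normSq-*-<1 {q} {q ^ n * q} q<1 (power<1 n))

-- Meaningful for k ≤ n only, as n ∸ k truncates.
qBinomial : (q : ℂ) → ∣ q ∣< 1ℝ → (n k : ℕ) → ℂ
qBinomial q ∣q∣<1 n k =
  qPochhammer q q n / (qPochhammer q q k * qPochhammer q q (n ∸ k))
    [ Complex.*-nonzero {qPochhammer q q k}
        (qPochhammer-nonzero q ∣q∣<1 k) (qPochhammer-nonzero q ∣q∣<1 (n ∸ k)) ]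

-- Φ_m^(α)(x,y|q)
hahn : (q : ℂ) → ∣ q ∣< 1ℝ → (m : ℕ) (α x y : ℂ) → ℂ
hahn q ∣q∣<1 m α x y =
  ∑[ i ≤ m ] (let k = toℕ i in
    qBinomial q ∣q∣<1 m k * qPochhammer α q k * x ^ k * y ^ (m ∸ k))

-- r_m(b,x|q)
rogersSzegő : (q : ℂ) → ∣ q ∣< 1ℝ → (m : ℕ) (b x : ℂ) → ℂ
rogersSzegő q ∣q∣<1 m b x =
  ∑[ i ≤ m ] (let k = toℕ i in qBinomial q ∣q∣<1 m k * b ^ k * x ^ (m ∸ k))

Function : Set
Function = Func setoid setoid

monomial : ℕ → Function
monomial m = record { to = _^ m ; cong = ^-congˡ m }

-- g = D_q f.  Limits and the case distinction on x = 0 are not computable, so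
-- D_q is given by its graph; the two conditions determine g up to ≈.
record IsDq (q : ℂ) (f g : Function) : Set where
  quotient : ∀ x → Nonzero x → ℂ
  quotient x x≢0 = ((f ⟨$⟩ x) - (f ⟨$⟩ (q * x))) / x [ x≢0 ]
  field
    away-from-0 : ∀ x (x≢0 : Nonzero x) → (g ⟨$⟩ x) ≈ quotient x x≢0
    at-0        : HasLimitAt0 quotient (g ⟨$⟩ 0#)

-- H_n(bD_q){f} = h
record HeineOp (q : ℂ) (∣q∣<1 : ∣ q ∣< 1ℝ) (b : ℂ) (n : ℕ) (f : Function) (h : ℂ → ℂ) : Set where
  field
    iterate      : ℕ → Function
    iterate-zero : ∀ x → (iterate 0 ⟨$⟩ x) ≈ (f ⟨$⟩ x)
    iterate-suc  : ∀ k → IsDq q (iterate k) (iterate (suc k))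
    hasSum       : ∀ x → HasSum (λ k →
      qPochhammer (q ^ n) q k / qPochhammer q q k [ qPochhammer-nonzero q ∣q∣<1 k ]
        * b ^ k * (iterate k ⟨$⟩ x)) (h x)

-- H_∞(bD_q){f} = h, the pointwise limit of H_n(bD_q){f}
record HeineOp∞ (q : ℂ) (∣q∣<1 : ∣ q ∣< 1ℝ) (b : ℂ) (f : Function) (h : ℂ → ℂ) : Set where
  field
    value     : ℕ → ℂ → ℂ
    isHeineOp : ∀ n → HeineOp q ∣q∣<1 b n f (value n)
    converges : ∀ x → Converges (λ n → value n x) (h x)

{-# OPTIONS --safe #-}

-- D_q lowers the degree of a monomial, D_q x^j = (1 − q^j) x^{j−1}, so the series for
-- H_n(bD_q){x^m} stops at k = m, and its k-th coefficient is the q-binomial one because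
-- (1 − q^m)(1 − q^{m−1})⋯(1 − q^{m−k+1}) = (q;q)_m / (q;q)_{m−k}.  For n = 0 only k = 0
-- survives since (1;q)_k = 0 for k ≥ 1; for n → ∞ each (q^n;q)_k tends to 1 since q^n → 0,
-- by Bernoulli's inequality.

module Submission where

open import Algebra.Bundles using (CommutativeRing; CommutativeSemiring)
import Algebra.Properties.CommutativeSemiring.Exp as CommutativeExp
import Algebra.Properties.Semiring.Exp as SemiringExp
import Algebra.Properties.Semiring.Sum as SemiringSum
import Algebra.Solver.Ring.NaturalCoefficients.Default as NaturalCoefficients
open import Data.Fin.Base using (Fin; zero; suc; toℕ)
import Data.Fin.Properties as Finₚ
open import Data.Integer.Base as ℤ using (+_)
import Data.Integer.Properties as ℤₚ
open import Data.Nat.Base as ℕ using (ℕ; zero; suc; pred; _∸_; z≤n; s≤s)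
import Data.Nat.Properties as ℕₚ
open import Data.Product.Base using (∃; _×_; _,_; Σ; proj₁)
import Data.Rational.Base
open import Data.Rational.Base as ℚ using (ℚ; 0ℚ; 1ℚ; ½; mkℚ)
import Data.Rational.Properties as ℚₚ
open import Data.Rational.Unnormalised.Base as ℚᵘ using (mkℚᵘ; *≤*; *≡*)
import Data.Rational.Unnormalised.Properties as ℚᵘₚ
open import Data.Sum.Base using (inj₁; inj₂)
open import Function.Base using (_∘_)
open import Function.Bundles using (_⟨$⟩_)
open import Relation.Binary.PropositionalEquality as ≡ using (_≡_)
import Relation.Binary.Reasoning.Setoid as SetoidReasoning
import Tactic.RingSolver as RingSolver

import Defs
open Defs.Real using (ℚ-solver; seq)
open Defs.Real.Rational

open SemiringExp (CommutativeRing.semiring ℚₚ.+-*-commutativeRing) using () renaming (_^_ to _^ℚ_)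

-- Rational estimates: Archimedean property, Bernoulli's inequality, powers of r < 1.

module _ where
  open Data.Rational.Base using (_+_; _*_; _-_; -_; _≤_)

  fromℕ : ℕ → ℚ
  fromℕ n = + n ℚ./ 1

  abstract
    0≤⇒≤+ : ∀ {x p} → 0ℚ ≤ x → p ≤ p + x
    0≤⇒≤+ {x} {p} 0≤x = ≡.subst (_≤ p + x) (ℚₚ.+-identityʳ p) (ℚₚ.+-monoʳ-≤ p 0≤x)

    ≤-from-difference : ∀ {s p} → 0ℚ ≤ p - s → s ≤ p
    ≤-from-difference {s} {p} h =
      ≡.subst (s ≤_) (cancel s p) (0≤⇒≤+ h)
      where
      cancel : ∀ s p → s + (p - s) ≡ p
      cancel = RingSolver.solve-∀ ℚ-solver

    -- The fraction n/1 is normalised by a gcd that does not reduce for a variable `n`, so the two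
    -- sides are compared as unnormalised fractions.
    fromℕ-suc : ∀ n → fromℕ (suc n) ≡ 1ℚ + fromℕ n
    fromℕ-suc n = ℚₚ.toℚᵘ-injective (ℚᵘₚ.≃-trans (ℚₚ.toℚᵘ-fromℚᵘ (mkℚᵘ (+ suc n) 0))
      (ℚᵘₚ.≃-trans sum≃ (ℚᵘₚ.≃-sym (ℚᵘₚ.≃-trans (ℚₚ.toℚᵘ-homo-+ 1ℚ (fromℕ n))
        (ℚᵘₚ.+-congʳ ℚᵘ.1ℚᵘ (ℚₚ.toℚᵘ-fromℚᵘ (mkℚᵘ (+ n) 0)))))))
      where
      sum≃ : mkℚᵘ (+ suc n) 0 ℚᵘ.≃ ℚᵘ.1ℚᵘ ℚᵘ.+ mkℚᵘ (+ n) 0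
      sum≃ = *≡* (≡.cong (λ t → (+ 1 ℤ.+ t) ℤ.* + 1) (≡.sym (ℤₚ.*-identityʳ (+ n))))

    fromℕ-nonNeg : ∀ n → 0ℚ ≤ fromℕ n
    fromℕ-nonNeg n = ℚₚ.toℚᵘ-cancel-≤ (ℚᵘₚ.≤-respʳ-≃
      (ℚᵘₚ.≃-sym (ℚₚ.toℚᵘ-fromℚᵘ (mkℚᵘ (+ n) 0)))
      (*≤* (≡.subst (ℤ.0ℤ ℤ.≤_) (≡.sym (ℤₚ.*-identityʳ (+ n))) (ℤ.+≤+ ℕ.z≤n))))

    -- A positive `t` is (a+1)/(d+1), and n ≥ d+1 gives n(a+1) ≥ d+1, which is the claim with the
    -- denominator cleared. Numerators that are zero or negative contradict 0 < t.
    archimedean : ∀ {t} → 0ℚ ℚ.< t → ∃ λ N → ∀ n → N ℕ.≤ n → 1ℚ ≤ fromℕ n * t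
    archimedean {mkℚ (+ zero) d c}   (ℚ.*<* (ℤ.+<+ ()))
    archimedean {mkℚ ℤ.-[1+ a ] d c} (ℚ.*<* ())
    archimedean {t@(mkℚ (+ suc a) d c)} _ = suc d , λ n d<n →
      ℚₚ.toℚᵘ-cancel-≤ (ℚᵘₚ.≤-respʳ-≃
        (ℚᵘₚ.≃-sym (ℚᵘₚ.≃-trans (ℚₚ.toℚᵘ-homo-* (fromℕ n) t)
          (ℚᵘₚ.*-congʳ {ℚ.toℚᵘ t} (ℚₚ.toℚᵘ-fromℚᵘ (mkℚᵘ (+ n) 0)))))
        (*≤* (bound n d<n)))
      where
      bound : ∀ n → suc d ℕ.≤ n →
        + 1 ℤ.* ℚᵘ.↧ (mkℚᵘ (+ n) 0 ℚᵘ.* ℚ.toℚᵘ t) ℤ.≤ (+ n ℤ.* + suc a) ℤ.* + 1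
      bound n d<n = ≡.subst₂ ℤ._≤_
        (≡.cong +_ (≡.sym (≡.trans (ℕₚ.*-identityˡ (1 ℕ.* suc d)) (ℕₚ.*-identityˡ (suc d)))))
        (≡.trans (ℤₚ.pos-* n (suc a)) (≡.sym (ℤₚ.*-identityʳ (+ n ℤ.* + suc a))))
        (ℤ.+≤+ (ℕₚ.≤-trans d<n (ℕₚ.m≤m*n n (suc a))))

    ^-nonNeg : ∀ {r} → 0ℚ ≤ r → ∀ n → 0ℚ ≤ r ^ℚ n
    ^-nonNeg 0≤r zero    = ℚₚ.nonNegative⁻¹ 1ℚ
    ^-nonNeg 0≤r (suc n) = 0≤a*b 0≤r (^-nonNeg 0≤r n)

    -- A division-free way to bound r^n by 1/(1 + ng) when r = 1 - g.
    bernoulli : ∀ {r g} → 0ℚ ≤ r → 0ℚ ≤ g → r + g ≡ 1ℚ →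
      ∀ n → r ^ℚ n * (1ℚ + fromℕ n * g) ≤ 1ℚ
    bernoulli {r} {g} 0≤r 0≤g eq zero = ℚₚ.≤-reflexive
      (≡.trans (ℚₚ.*-identityˡ (1ℚ + 0ℚ * g))
        (≡.trans (≡.cong (λ t → 1ℚ + t) (ℚₚ.*-zeroˡ g)) (ℚₚ.+-identityʳ 1ℚ)))
    bernoulli {r} {g} 0≤r 0≤g eq (suc n) = begin
      (r * s) * (1ℚ + fromℕ (suc n) * g)       ≡⟨ ≡.cong (λ t → (r * s) * (1ℚ + t * g)) (fromℕ-suc n) ⟩
      (r * s) * (1ℚ + (1ℚ + fromℕ n) * g)      ≡⟨ ≡.cong (λ t → (r * s) * (1ℚ + t)) distrib ⟩
      (r * s) * (1ℚ + (g + fromℕ n * g))       ≡⟨ expand r s 1ℚ g (fromℕ n * g) ⟩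
      -- Since r ≤ 1 ≤ `u`, the last `r` may be raised to `u`; then r + g = 1 factors out and the
      -- induction hypothesis remains.
      r * s * u + (s * g) * r                  ≤⟨ ℚₚ.+-monoʳ-≤ (r * s * u) (ℚₚ.*-monoˡ-≤-nonNeg (s * g) {{0≤sg}} r≤u) ⟩
      r * s * u + (s * g) * u                  ≡⟨ collect r s u g ⟩
      (r + g) * (s * u)                        ≡⟨ ≡.trans (≡.cong (_* (s * u)) eq) (ℚₚ.*-identityˡ (s * u)) ⟩
      s * u                                    ≤⟨ bernoulli 0≤r 0≤g eq n ⟩
      1ℚ                                       ∎
      where
      open ℚₚ.≤-Reasoning
      s u : ℚ
      s = r ^ℚ n
      u = 1ℚ + fromℕ n * g
      distrib : (1ℚ + fromℕ n) * g ≡ g + fromℕ n * g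
      distrib = ≡.trans (ℚₚ.*-distribʳ-+ g 1ℚ (fromℕ n)) (≡.cong (_+ fromℕ n * g) (ℚₚ.*-identityˡ g))
      0≤sg : ℚ.NonNegative (s * g)
      0≤sg = ℚ.nonNegative (0≤a*b (^-nonNeg 0≤r n) 0≤g)
      r≤u : r ≤ u
      r≤u = ℚₚ.≤-trans (≡.subst (r ≤_) eq (0≤⇒≤+ 0≤g)) (0≤⇒≤+ (0≤a*b (fromℕ-nonNeg n) 0≤g))
      expand : ∀ r s o g t → (r * s) * (o + (g + t)) ≡ r * s * (o + t) + (s * g) * r
      expand = RingSolver.solve-∀ ℚ-solver
      collect : ∀ r s u g → r * s * u + (s * g) * u ≡ (r + g) * (s * u)
      collect = RingSolver.solve-∀ ℚ-solver

    -- The Archimedean property at p g gives 1 ≤ n p g, hence r^n ≤ p · (r^n · n g), and Bernoulli's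
    -- inequality bounds the bracket by 1.
    ^-null : ∀ {r g} → 0ℚ ≤ r → 0ℚ ℚ.< g → r + g ≡ 1ℚ →
      ∀ {p} → 0ℚ ℚ.< p → ∃ λ N → ∀ n → N ℕ.≤ n → r ^ℚ n ≤ p
    ^-null {r} {g} 0≤r 0<g eq {p} 0<p =
      let N , h = archimedean (0<a*b 0<p 0<g) in N , λ n N≤n → let s = r ^ℚ n ; k = fromℕ n in begin
        s                       ≡⟨ ℚₚ.*-identityʳ s ⟨
        s * 1ℚ                  ≤⟨ ℚₚ.*-monoˡ-≤-nonNeg s {{ℚ.nonNegative (^-nonNeg 0≤r n)}} (h n N≤n) ⟩
        s * (k * (p * g))       ≡⟨ swap s k p g ⟩
        -- Adding the nonnegative `s` completes the product that Bernoulli's inequality bounds.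
        p * (s * (k * g))       ≤⟨ scale (0≤⇒≤+ (^-nonNeg 0≤r n)) ⟩
        p * (s * (k * g) + s)   ≡⟨ ≡.cong (λ t → p * (s * (k * g) + t)) (ℚₚ.*-identityʳ s) ⟨
        p * (s * (k * g) + s * 1ℚ)  ≡⟨ ≡.cong (p *_) (merge s (k * g) 1ℚ) ⟩
        p * (s * (1ℚ + k * g))  ≤⟨ scale (bernoulli 0≤r (ℚₚ.<⇒≤ 0<g) eq n) ⟩
        p * 1ℚ                  ≡⟨ ℚₚ.*-identityʳ p ⟩
        p                       ∎
      where
      open ℚₚ.≤-Reasoning
      scale : ∀ {a b} → a ≤ b → p * a ≤ p * b
      scale = ℚₚ.*-monoˡ-≤-nonNeg p {{ℚ.nonNegative (ℚₚ.<⇒≤ 0<p)}}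
      swap : ∀ s k p g → s * (k * (p * g)) ≡ p * (s * (k * g))
      swap = RingSolver.solve-∀ ℚ-solver
      merge : ∀ s t o → s * t + s * o ≡ s * (o + t)
      merge = RingSolver.solve-∀ ℚ-solver

    p≤∣p∣ : ∀ p → p ≤ ℚ.∣ p ∣
    p≤∣p∣ p with ℚₚ.≤-total 0ℚ p
    ... | inj₁ 0≤p = ℚₚ.≤-reflexive (≡.sym (ℚₚ.0≤p⇒∣p∣≡p 0≤p))
    ... | inj₂ p≤0 = ℚₚ.≤-trans p≤0 (ℚₚ.0≤∣p∣ p)

-- Semiring identities behind the limit laws and the monomial computations.

module Identities {c ℓ} (R : CommutativeSemiring c ℓ) where
  open CommutativeSemiring R
  open NaturalCoefficients R

  abstract
    +-perturb : ∀ l e k f → (l + e) + (k + f) ≈ (l + k) + (e + f)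
    +-perturb = solve 4 (λ l e k f → (l :+ e) :+ (k :+ f) := (l :+ k) :+ (e :+ f)) refl

    *-perturb : ∀ l e k f → (l + e) * (k + f) ≈ l * k + (l * f + (k * e + e * f))
    *-perturb = solve 4 (λ l e k f →
      (l :+ e) :* (k :+ f) := l :* k :+ (l :* f :+ (k :* e :+ e :* f))) refl

    power-split : ∀ c x y r p → c * ((r * x) * (p * y)) ≈ (r * p) * (c * (x * y))
    power-split = solve 5 (λ c x y r p →
      c :* ((r :* x) :* (p :* y)) := (r :* p) :* (c :* (x :* y))) refl

    -- Brings `i`, later the reciprocal of `x`, next to `x` so that they cancel.
    quotient-rearrange : ∀ t c x y i → t * (c * (x * y)) * i ≈ (i * x) * (c * t * y)
    quotient-rearrange = solve 5 (λ t c x y i →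
      t :* (c :* (x :* y)) :* i := (i :* x) :* (c :* t :* y)) refl

    -- Brings the falling product `c` next to the reciprocal `i` of (q;q)_k; together they make the
    -- q-binomial coefficient.
    coefficient-rearrange : ∀ a i p c x → a * i * p * (c * x) ≈ (c * i) * a * p * x
    coefficient-rearrange = solve 5 (λ a i p c x →
      a :* i :* p :* (c :* x) := (c :* i) :* a :* p :* x) refl

-- Rational bounds on squared moduli.

open import Defs
open import Data.Nat.Base using (_≤_)

-- |z|² ≤ p, as a rational bound on the Cauchy sequence of |z|² from some index on.
infix 4 _≲_
record _≲_ (z : ℂ) (p : ℚ) : Set where
  constructor mk≲
  field
    from  : ℕ
    bound : ∀ n → from ℕ.≤ n → seq (normSq z) n ℚ.≤ p

module _ where
  open Data.Rational.Base using () renaming (_+_ to _+ℚ_; _*_ to _*ℚ_; _-_ to _-ℚ_; -_ to -ℚ_)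

  abstract
    normSq-nonNeg : ∀ z n → 0ℚ ℚ.≤ seq (normSq z) n
    normSq-nonNeg z = Real.sum-of-squares-nonNeg (re z) (im z)

    ≲-mono : ∀ {z p r} → p ℚ.≤ r → z ≲ p → z ≲ r
    ≲-mono p≤r (mk≲ N h) = mk≲ N λ n N≤n → ℚₚ.≤-trans (h n N≤n) p≤r

    0≲ : ∀ {p} → 0ℚ ℚ.≤ p → 0# ≲ p
    0≲ 0≤p = mk≲ 0 λ _ _ → 0≤p

    1≲1 : 1# ≲ 1ℚ
    1≲1 = mk≲ 0 λ _ _ → ℚₚ.≤-refl

    -- |z + w|² + |z − w|² = 2 (|z|² + |w|²)
    ≲-+ : ∀ {z w p} → z ≲ p → w ≲ p → z + w ≲ (p +ℚ p) +ℚ (p +ℚ p)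
    ≲-+ {z} {w} {p} (mk≲ M f) (mk≲ N g) = mk≲ (M ℕ.⊔ N) λ n le →
      let l = ℚₚ.+-mono-≤ (f n (m⊔n≤o⇒m≤o le)) (g n (m⊔n≤o⇒n≤o {M} le))
          a = seq (re z) n ; b = seq (im z) n ; c = seq (re w) n ; d = seq (im w) n
      in ℚₚ.≤-trans
           (≡.subst (seq (normSq (z + w)) n ℚ.≤_) (parallelogram a b c d)
             (0≤⇒≤+ (normSq-nonNeg (z - w) n)))
           (ℚₚ.+-mono-≤ l l)
      where
      parallelogram : ∀ a b c d →
        ((a +ℚ c) *ℚ (a +ℚ c) +ℚ (b +ℚ d) *ℚ (b +ℚ d))
          +ℚ ((a +ℚ -ℚ c) *ℚ (a +ℚ -ℚ c) +ℚ (b +ℚ -ℚ d) *ℚ (b +ℚ -ℚ d))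
        ≡ ((a *ℚ a +ℚ b *ℚ b) +ℚ (c *ℚ c +ℚ d *ℚ d)) +ℚ ((a *ℚ a +ℚ b *ℚ b) +ℚ (c *ℚ c +ℚ d *ℚ d))
      parallelogram = RingSolver.solve-∀ ℚ-solver

    ≲-* : ∀ {z w p r} → 0ℚ ℚ.≤ p → z ≲ p → w ≲ r → z * w ≲ p *ℚ r
    ≲-* {z} {w} {p} {r} 0≤p (mk≲ M f) (mk≲ N g) = mk≲ (M ℕ.⊔ N) λ n le →
      ≡.subst (ℚ._≤ p *ℚ r) (norm-* (seq (re z) n) (seq (im z) n) (seq (re w) n) (seq (im w) n))
        (*-mono-≤ (normSq-nonNeg w n) 0≤p (f n (m⊔n≤o⇒m≤o le)) (g n (m⊔n≤o⇒n≤o {M} le)))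
      where
      norm-* : ∀ a b c d →
        (a *ℚ a +ℚ b *ℚ b) *ℚ (c *ℚ c +ℚ d *ℚ d)
          ≡ (a *ℚ c +ℚ -ℚ (b *ℚ d)) *ℚ (a *ℚ c +ℚ -ℚ (b *ℚ d)) +ℚ (a *ℚ d +ℚ b *ℚ c) *ℚ (a *ℚ d +ℚ b *ℚ c)
      norm-* = RingSolver.solve-∀ ℚ-solver

    -- The bound concerns a representing sequence, so passing to an equal number costs a small
    -- positive error. Half of `p` is reserved for it.
    ≲-resp-≈ : ∀ {z w p} → 0ℚ ℚ.< p → z ≈ w → z ≲ ½ *ℚ p → w ≲ p
    ≲-resp-≈ {z} {w} {p} 0<p z≈w (mk≲ M f) =
      let N , g = Real.close (Real.≈-sym (Complex.normSq-cong z≈w)) (½ *ℚ p) (half-pos 0<p)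
      in mk≲ (M ℕ.⊔ N) λ n le → let s = seq (normSq z) n ; t = seq (normSq w) n in
           ≡.subst₂ ℚ._≤_ (cancel s t) (halves p)
             (ℚₚ.+-mono-≤ (f n (m⊔n≤o⇒m≤o le))
               (ℚₚ.≤-trans (p≤∣p∣ (t -ℚ s)) (g n (m⊔n≤o⇒n≤o {M} le))))
      where
      cancel : ∀ s t → s +ℚ (t -ℚ s) ≡ t
      cancel = RingSolver.solve-∀ ℚ-solver

    ≲-bounded : ∀ z → ∃ λ B → 0ℚ ℚ.< B × z ≲ B
    ≲-bounded z = let B , 0<B , N , h = Real.eventually-bounded (normSq z) in
      B , 0<B , mk≲ N λ n N≤n → ℚₚ.≤-trans (p≤∣p∣ (seq (normSq z) n)) (h n N≤n)

    -- Half of the rational gap between 0 and ε² serves as the bound `p`; the other half is the gap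
    -- that the strict inequality |z|² < ε² requires.
    ≲⇒∣∣< : ∀ {ε} → 0ℝ < ε → ∃ λ p → 0ℚ ℚ.< p × (∀ {z} → z ≲ p → ∣ z ∣< ε)
    ≲⇒∣∣< {ε} 0<ε = let 0<ε² = Real.mul-pos 0<ε 0<ε ; g = Real.gap 0<ε² in
      ½ *ℚ g , half-pos (Real.gap-pos 0<ε²) , λ {z} (mk≲ N h) → 0<ε ,
        Real.mk< (½ *ℚ g) (half-pos (Real.gap-pos 0<ε²)) (Real.from 0<ε² ℕ.⊔ N) λ n le →
          ≡.subst₂ ℚ._≤_ (half-left g)
            (drop (seq ε n *ℚ seq ε n) (seq (normSq z) n))
            (ℚₚ.+-mono-≤ (Real.gap-≤ 0<ε² n (m⊔n≤o⇒m≤o le))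
              (ℚₚ.neg-antimono-≤ (h n (m⊔n≤o⇒n≤o {Real.from 0<ε²} le))))
      where
      cancel : ∀ h → (h +ℚ h) -ℚ h ≡ h
      cancel = RingSolver.solve-∀ ℚ-solver
      half-left : ∀ g → g -ℚ ½ *ℚ g ≡ ½ *ℚ g
      half-left g = ≡.trans (≡.cong (_-ℚ ½ *ℚ g) (≡.sym (halves g))) (cancel (½ *ℚ g))
      drop : ∀ a b → (a -ℚ 0ℚ) -ℚ b ≡ a -ℚ b
      drop = RingSolver.solve-∀ ℚ-solver

    ∣∣<⇒≲ : ∀ {z δ} → ∣ z ∣< Real.fromℚ δ → z ≲ δ *ℚ δ
    ∣∣<⇒≲ {z} {δ} (_ , l) = mk≲ (Real.from l) λ n le →
      ≤-from-difference (ℚₚ.≤-trans (ℚₚ.<⇒≤ (Real.gap-pos l)) (Real.gap-≤ l n le))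

    fromℚ-pos : ∀ {δ} → 0ℚ ℚ.< δ → 0ℝ < Real.fromℚ δ
    fromℚ-pos {δ} 0<δ = Real.mk< δ 0<δ 0 λ _ _ → ℚₚ.≤-reflexive (drop δ)
      where
      drop : ∀ a → a ≡ a -ℚ 0ℚ
      drop = RingSolver.solve-∀ ℚ-solver

    ^-≲ : ∀ {z r} → 0ℚ ℚ.≤ r → z ≲ r → ∀ n → z ^ n ≲ r ^ℚ n
    ^-≲ 0≤r z≲r zero    = 1≲1
    ^-≲ {z} 0≤r z≲r (suc n) = ≲-* {z} {z ^ n} 0≤r z≲r (^-≲ {z} 0≤r z≲r n)

-- Limits of complex functions along a filter.

module ℂ-Ring = CommutativeRing Complex.commutativeRing
open import Algebra.Properties.Ring ℂ-Ring.ring using (-1*x≈-x; xyx⁻¹≈y; [y-z]x≈yx-zx; -0#≈0#)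
module ℂ-Identities = Identities ℂ-Ring.commutativeSemiring
module ≈-Reasoning = SetoidReasoning ℂ-Ring.setoid
open ≈-Reasoning

-- Limits of sequences and limits at 0 obey the same laws; this interface to "eventually" lets each
-- law be proved once.
record Filter : Set₁ where
  field
    Index      : Set
    Eventually : (Index → Set) → Set
    always     : ∀ {P} → (∀ i → P i) → Eventually P
    map        : ∀ {P Q} → (∀ i → P i → Q i) → Eventually P → Eventually Q
    both       : ∀ {P Q} → Eventually P → Eventually Q → Eventually (λ i → P i × Q i)

module Limits (F : Filter) where
  open Filter F

  -- Since `_≲_` bounds the squared modulus, `p` stands for ε².
  Null : (Index → ℂ) → Set
  Null u = ∀ p → 0ℚ ℚ.< p → Eventually (λ i → u i ≲ p)

  -- Asking for u i ≈ l + e i instead of a null u i - l keeps the identities behind the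
  -- limit laws free of cancellation.
  Tends : (Index → ℂ) → ℂ → Set
  Tends u l = ∃ λ e → Null e × (∀ i → u i ≈ l + e i)

  abstract
    null-cong : ∀ {u v} → (∀ i → u i ≈ v i) → Null u → Null v
    null-cong e h p 0<p = map (λ i → ≲-resp-≈ 0<p (e i)) (h (½ ℚ.* p) (half-pos 0<p))

    null-+ : ∀ {u v} → Null u → Null v → Null (λ i → u i + v i)
    null-+ {u} {v} f g p 0<p = map
      (λ i (a , b) → ≡.subst (u i + v i ≲_) quarters (≲-+ {u i} {v i} a b))
      (both (f s 0<s) (g s 0<s))
      where
      -- A quarter of `p`, because `≲-+` multiplies the common bound by four.
      s : ℚ
      s = ½ ℚ.* (½ ℚ.* p)
      0<s : 0ℚ ℚ.< s
      0<s = half-pos (half-pos 0<p)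
      quarters : (s ℚ.+ s) ℚ.+ (s ℚ.+ s) ≡ p
      quarters = ≡.trans (≡.cong (λ t → t ℚ.+ t) (halves (½ ℚ.* p))) (halves p)

    null-* : ∀ {u v} → Null u → Null v → Null (λ i → u i * v i)
    null-* {u} {v} f g p 0<p = map
      (λ i (a , b) →
        ≡.subst (u i * v i ≲_) (ℚₚ.*-identityʳ p) (≲-* {u i} {v i} (ℚₚ.<⇒≤ 0<p) a b))
      (both (f p 0<p) (g 1ℚ (ℚₚ.positive⁻¹ 1ℚ)))

    null-*ˡ : ∀ c {u} → Null u → Null (λ i → c * u i)
    null-*ˡ c {u} f p 0<p =
      let B , 0<B , c≲B = ≲-bounded c
          s , 0<s , eq = shrink 0<B 0<p
      in map (λ i a → ≡.subst (c * u i ≲_) eq (≲-* {c} {u i} (ℚₚ.<⇒≤ 0<B) c≲B a)) (f s 0<s)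

    difference-null : ∀ {u l} → Tends u l → Null (λ i → u i - l)
    difference-null {u} {l} (e , h , eq) = null-cong
      (λ i → ℂ-Ring.sym (ℂ-Ring.trans (ℂ-Ring.+-congʳ (eq i)) (xyx⁻¹≈y l (e i)))) h

    tends-const : ∀ l → Tends (λ _ → l) l
    tends-const l = (λ _ → 0#) , (λ p 0<p → always λ _ → 0≲ (ℚₚ.<⇒≤ 0<p)) ,
      λ _ → ℂ-Ring.sym (ℂ-Ring.+-identityʳ l)

    tends-cong : ∀ {u v l k} → (∀ i → u i ≈ v i) → l ≈ k → Tends u l → Tends v k
    tends-cong u≈v l≈k (e , h , eq) = e , h , λ i →
      ℂ-Ring.trans (ℂ-Ring.sym (u≈v i)) (ℂ-Ring.trans (eq i) (ℂ-Ring.+-congʳ l≈k))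

    tends-+ : ∀ {u v l k} → Tends u l → Tends v k → Tends (λ i → u i + v i) (l + k)
    tends-+ {l = l} {k} (e , h , eq) (f , g , eq′) = (λ i → e i + f i) , null-+ h g , λ i →
      ℂ-Ring.trans (ℂ-Ring.+-cong (eq i) (eq′ i)) (ℂ-Identities.+-perturb l (e i) k (f i))

    tends-* : ∀ {u v l k} → Tends u l → Tends v k → Tends (λ i → u i * v i) (l * k)
    tends-* {l = l} {k} (e , h , eq) (f , g , eq′) =
      (λ i → l * f i + (k * e i + e i * f i)) ,
      null-+ (null-*ˡ l g) (null-+ (null-*ˡ k h) (null-* h g)) , λ i →
      ℂ-Ring.trans (ℂ-Ring.*-cong (eq i) (eq′ i)) (ℂ-Identities.*-perturb l (e i) k (f i))

    tends-*ˡ : ∀ c {u l} → Tends u l → Tends (λ i → c * u i) (c * l)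
    tends-*ˡ c = tends-* (tends-const c)

    tends-*ʳ : ∀ c {u l} → Tends u l → Tends (λ i → u i * c) (l * c)
    tends-*ʳ c h = tends-* h (tends-const c)

    tends-neg : ∀ {u l} → Tends u l → Tends (λ i → - u i) (- l)
    tends-neg {u} {l} h = tends-cong (λ i → -1*x≈-x (u i)) (-1*x≈-x l) (tends-*ˡ (- 1#) h)

    tends-^ : ∀ {u l} → Tends u l → ∀ n → Tends (λ i → u i ^ n) (l ^ n)
    tends-^ f zero    = tends-const 1#
    tends-^ f (suc n) = tends-* f (tends-^ f n)

    tends-sum : ∀ {n} {u : Index → Fin n → ℂ} {l : Fin n → ℂ} →
      (∀ j → Tends (λ i → u i j) (l j)) → Tends (λ i → sum (u i)) (sum l)
    tends-sum {zero}  h = tends-const 0#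
    tends-sum {suc n} h = tends-+ (h zero) (tends-sum (h ∘ suc))

-- The filters at infinity and at 0, and the limit of the powers of q.

atTop : Filter
atTop = record
  { Index      = ℕ
  ; Eventually = λ P → ∃ λ N → ∀ n → N ≤ n → P n
  ; always     = λ h → 0 , λ n _ → h n
  ; map        = λ f (N , h) → N , λ n le → f n (h n le)
  ; both       = λ (M , f) (N , g) → M ℕ.⊔ N , λ n le → f n (m⊔n≤o⇒m≤o le) , g n (m⊔n≤o⇒n≤o {M} le)
  }

-- An index carries the proof that x is nonzero, because the difference quotient takes it as an
-- argument. The radius `δ` bounds |x|², not |x|.
punctured-0 : Filter
punctured-0 = record
  { Index      = Σ ℂ Nonzero
  ; Eventually = λ P → ∃ λ δ → 0ℚ ℚ.< δ × ∀ x → proj₁ x ≲ δ → P x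
  ; always     = λ h → 1ℚ , ℚₚ.positive⁻¹ 1ℚ , λ x _ → h x
  ; map        = λ f (δ , 0<δ , h) → δ , 0<δ , λ x le → f x (h x le)
  ; both       = λ (δ , 0<δ , f) (γ , 0<γ , g) → δ ℚ.⊓ γ , min-pos 0<δ 0<γ ,
      λ x le → f x (≲-mono (ℚₚ.p⊓q≤p δ γ) le) , g x (≲-mono (ℚₚ.p⊓q≤q δ γ) le)
  }
  where
  min-pos : ∀ {δ γ} → 0ℚ ℚ.< δ → 0ℚ ℚ.< γ → 0ℚ ℚ.< δ ℚ.⊓ γ
  min-pos {δ} {γ} 0<δ 0<γ with ℚₚ.⊓-sel δ γ
  ... | inj₁ e = ≡.subst (0ℚ ℚ.<_) (≡.sym e) 0<δ
  ... | inj₂ e = ≡.subst (0ℚ ℚ.<_) (≡.sym e) 0<γ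

module Seq = Limits atTop
module Near0 = Limits punctured-0

abstract
  null⇒converges : ∀ u l → Seq.Null (λ n → u n - l) → Converges u l
  null⇒converges u l h ε 0<ε = let p , 0<p , f = ≲⇒∣∣< 0<ε ; N , g = h p 0<p in
    N , λ n N≤n → f (g n N≤n)

  null⇒hasLimitAt0 : ∀ φ l → Near0.Null (λ (x , x≢0) → φ x x≢0 - l) → HasLimitAt0 φ l
  null⇒hasLimitAt0 φ l h ε 0<ε =
    let p , 0<p , f = ≲⇒∣∣< 0<ε
        δ , 0<δ , g = h p 0<p
        γ , 0<γ , γ²≤δ = square-≤ 0<δ
    in Real.fromℚ γ , fromℚ-pos 0<γ , λ x x≢0 ∣x∣<γ →
         f (g (x , x≢0) (≲-mono γ²≤δ (∣∣<⇒≲ {x} ∣x∣<γ)))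
    where
    -- A radius `γ` for |x| is wanted from a bound `δ` on |x|². Taking the smaller of `δ` and 1
    -- gives γ² ≤ δ without a square root.
    square-≤ : ∀ {δ} → 0ℚ ℚ.< δ → ∃ λ γ → 0ℚ ℚ.< γ × γ ℚ.* γ ℚ.≤ δ
    square-≤ {δ} 0<δ with ℚₚ.≤-total δ 1ℚ
    ... | inj₁ δ≤1 = δ , 0<δ , ≡.subst (δ ℚ.* δ ℚ.≤_) (ℚₚ.*-identityʳ δ)
            (ℚₚ.*-monoˡ-≤-nonNeg δ {{ℚ.nonNegative (ℚₚ.<⇒≤ 0<δ)}} δ≤1)
    ... | inj₂ 1≤δ = 1ℚ , ℚₚ.positive⁻¹ 1ℚ , 1≤δ

  near0-id : Near0.Tends proj₁ 0#
  near0-id = proj₁ , (λ p 0<p → p , 0<p , λ _ h → h) , λ (x , _) → ℂ-Ring.sym (ℂ-Ring.+-identityˡ x)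

  -- The gap `g` in |q|² < 1 yields |q|² ≤ r with r = 1 - g, hence |q^n|² ≤ r^n, and `^-null`
  -- applies.
  powers-tend-0 : ∀ q → ∣ q ∣< 1ℝ → Seq.Tends (q ^_) 0#
  powers-tend-0 q ∣q∣<1 = (q ^_) , null , λ n → ℂ-Ring.sym (ℂ-Ring.+-identityˡ (q ^ n))
    where
    open Data.Rational.Base using () renaming (_-_ to _-ℚ_; _+_ to _+ℚ_)
    q<1 : normSq q < 1ℝ
    q<1 = Complex.mod<1 {q} ∣q∣<1
    g r : ℚ
    g = Real.gap q<1
    r = 1ℚ -ℚ g
    swap : ∀ o g s → (o -ℚ s) -ℚ g ≡ (o -ℚ g) -ℚ s
    swap = RingSolver.solve-∀ ℚ-solver
    cancel : ∀ o g → (o -ℚ g) +ℚ g ≡ o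
    cancel = RingSolver.solve-∀ ℚ-solver
    r+g≡1 : r +ℚ g ≡ 1ℚ
    r+g≡1 = cancel 1ℚ g
    q≲r : q ≲ r
    q≲r = mk≲ (Real.from q<1) λ n le → ≤-from-difference
      (≡.subst (0ℚ ℚ.≤_) (swap 1ℚ g (Real.seq (normSq q) n))
        (≡.subst (ℚ._≤ (1ℚ -ℚ Real.seq (normSq q) n) -ℚ g) (ℚₚ.+-inverseʳ g)
          (ℚₚ.+-monoˡ-≤ (ℚ.- g) (Real.gap-≤ q<1 n le))))
    -- The sign of 1 - g is read off from one index at which `r` bounds the nonnegative |q|².
    0≤r : 0ℚ ℚ.≤ r
    0≤r = ℚₚ.≤-trans (normSq-nonNeg q (_≲_.from q≲r)) (_≲_.bound q≲r _ ℕₚ.≤-refl)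
    null : Seq.Null (q ^_)
    null p 0<p = let N , h = ^-null 0≤r (Real.gap-pos q<1) r+g≡1 0<p in
      N , λ n N≤n → ≲-mono (h n N≤n) (^-≲ {q} 0≤r q≲r n)

-- Reciprocals, terminating series and q-Pochhammer symbols.

open ℂ-Ring using
  ( refl; sym; trans; +-cong; +-congˡ; +-congʳ; +-identityʳ
  ; *-cong; *-congˡ; *-congʳ; *-assoc; *-comm; *-identityˡ; *-identityʳ
  ; zeroˡ; zeroʳ; -‿cong; -‿inverseʳ )
open CommutativeExp ℂ-Ring.commutativeSemiring using (^-distrib-*)
open SemiringSum ℂ-Ring.semiring using (sum-cong-≋; sum-replicate-zero)

abstract
  x-0≈x : ∀ x → x - 0# ≈ x
  x-0≈x x = trans (+-congˡ -0#≈0#) (+-identityʳ x)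

  recip-unique : ∀ {z y} (nz : Nonzero z) → y * z ≈ 1# → y ≈ Complex.recip z nz
  recip-unique {z} {y} nz e = begin
    y                          ≈⟨ *-identityʳ y ⟨
    y * 1#                     ≈⟨ *-congˡ (trans (*-comm z z⁻¹) (Complex.recip-inverseˡ z nz)) ⟨
    y * (z * z⁻¹)              ≈⟨ *-assoc y z z⁻¹ ⟨
    (y * z) * z⁻¹              ≈⟨ *-congʳ e ⟩
    1# * z⁻¹                   ≈⟨ *-identityˡ z⁻¹ ⟩
    z⁻¹                        ∎
    where
    z⁻¹ : ℂ
    z⁻¹ = Complex.recip z nz

  1/1≈1 : ∀ nz → 1# / 1# [ nz ] ≈ 1#
  1/1≈1 nz = trans (*-comm 1# (Complex.recip 1# nz)) (Complex.recip-inverseˡ 1# nz)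

  sum-zero : ∀ n (a : ℕ → ℂ) → (∀ k → a k ≈ 0#) → ∑[ k < n ] a (toℕ k) ≈ 0#
  sum-zero n a e = trans (sum-cong-≋ {n} (λ k → e (toℕ k))) (sum-replicate-zero n)

  -- Sums unfold at their first term, so the induction peels off common leading terms and shifts the
  -- sequence until only zeros are left.
  sum-truncate : ∀ {M N} (a : ℕ → ℂ) → (∀ k → M ≤ k → a k ≈ 0#) → M ≤ N →
    ∑[ k < N ] a (toℕ k) ≈ ∑[ k < M ] a (toℕ k)
  sum-truncate {N = N} a e z≤n = sum-zero N a (λ k → e k z≤n)
  sum-truncate a e (s≤s M≤N) = +-congˡ (sum-truncate (a ∘ suc) (λ k M≤k → e (suc k) (s≤s M≤k)) M≤N)

  -- From `M` on every partial sum equals `s`, so its difference from `s` is 0 and satisfies any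
  -- positive bound.
  finite-hasSum : ∀ {a s} M → (∀ k → M ≤ k → a k ≈ 0#) → ∑[ k < M ] a (toℕ k) ≈ s → HasSum a s
  finite-hasSum {a} {s} M e eq = null⇒converges (λ n → ∑[ k < n ] a (toℕ k)) s
    λ p 0<p → M , λ n M≤n → ≲-resp-≈ 0<p
    (sym (trans (+-congʳ (trans (sum-truncate a e M≤n) eq)) (-‿inverseʳ s)))
    (0≲ (ℚₚ.<⇒≤ (half-pos 0<p)))

  -- The factor of index 0 is 1 - 1, and it stays in every longer product.
  qPochhammer-1 : ∀ q k → qPochhammer (q ^ 0) q (suc k) ≈ 0#
  qPochhammer-1 q zero    = trans
    (*-identityˡ (1# - 1# * 1#)) (trans (+-congˡ (-‿cong (*-identityˡ 1#))) (-‿inverseʳ 1#))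
  qPochhammer-1 q (suc k) = trans (*-congʳ (qPochhammer-1 q k)) (zeroˡ (1# - q ^ suc k * q ^ 0))

  -- The number of factors is fixed while n grows, and each factor 1 - q^k q^n tends to 1.
  qPochhammer-tends-1 : ∀ q → ∣ q ∣< 1ℝ → ∀ k → Seq.Tends (λ n → qPochhammer (q ^ n) q k) 1#
  qPochhammer-tends-1 q ∣q∣<1 zero    = Seq.tends-const 1#
  qPochhammer-tends-1 q ∣q∣<1 (suc k) = Seq.tends-cong (λ _ → refl) limit
    (Seq.tends-* (qPochhammer-tends-1 q ∣q∣<1 k)
      (Seq.tends-+ (Seq.tends-const 1#) (Seq.tends-neg (Seq.tends-*ˡ (q ^ k) (powers-tend-0 q ∣q∣<1)))))
    where
    limit : 1# * (1# - q ^ k * 0#) ≈ 1#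
    limit = trans (*-identityˡ _) (trans (+-congˡ (-‿cong (zeroʳ (q ^ k)))) (x-0≈x 1#))

-- The q-derivative on monomials and its iterates.

scaledMonomial : ℂ → ℕ → Function
scaledMonomial c j = record { to = λ x → c * x ^ j ; cong = λ e → *-congˡ (^-congˡ j e) }

module _ (q : ℂ) where

  abstract
    scaledMonomial-quotient : ∀ c j x (x≢0 : Nonzero x) →
      (c * x ^ j - c * (q * x) ^ j) / x [ x≢0 ] ≈ c * (1# - q ^ j) * x ^ pred j
    -- Here `pred` sends 0 to 0; this is harmless, as the coefficient contains 1 - q⁰ = 0.
    scaledMonomial-quotient c zero x x≢0 = trans
      (trans (*-congʳ (-‿inverseʳ (c * 1#))) (zeroˡ (Complex.recip x x≢0)))
      (sym (trans (*-congʳ (trans (*-congˡ (-‿inverseʳ 1#)) (zeroʳ c))) (zeroˡ 1#)))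
    scaledMonomial-quotient c (suc j) x x≢0 = begin
      (c * x ^ suc j - c * (q * x) ^ suc j) * i
        ≈⟨ *-congʳ (+-congˡ (-‿cong (trans (*-congˡ (*-congˡ (^-distrib-* q x j)))
             (ℂ-Identities.power-split c x (x ^ j) q (q ^ j))))) ⟩
      (P - q ^ suc j * P) * i
        ≈⟨ *-congʳ (+-congʳ (*-identityˡ P)) ⟨
      (1# * P - q ^ suc j * P) * i
        ≈⟨ *-congʳ ([y-z]x≈yx-zx P 1# (q ^ suc j)) ⟨
      (1# - q ^ suc j) * P * i
        ≈⟨ ℂ-Identities.quotient-rearrange (1# - q ^ suc j) c x (x ^ j) i ⟩
      (i * x) * (c * (1# - q ^ suc j) * x ^ j)
        ≈⟨ trans (*-congʳ (Complex.recip-inverseˡ x x≢0)) (*-identityˡ _) ⟩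
      c * (1# - q ^ suc j) * x ^ j ∎
      where
      i P : ℂ
      i = Complex.recip x x≢0
      P = c * x ^ suc j

  -- Scaled monomials are closed under D_q because the coefficient absorbs 1 - q^j. Away from 0 the
  -- quotient is itself a scaled monomial, so the limit at 0 is the continuity of that monomial.
  scaledMonomial-IsDq : ∀ c j → IsDq q (scaledMonomial c j) (scaledMonomial (c * (1# - q ^ j)) (pred j))
  scaledMonomial-IsDq c j = record
    { away-from-0 = λ x x≢0 → sym (scaledMonomial-quotient c j x x≢0)
    ; at-0        = null⇒hasLimitAt0 (λ x x≢0 → (c * x ^ j - c * (q * x) ^ j) / x [ x≢0 ])
        (c * (1# - q ^ j) * 0# ^ pred j) (Near0.difference-null (Near0.tends-cong
        (λ (x , x≢0) → sym (scaledMonomial-quotient c j x x≢0)) refl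
        (Near0.tends-*ˡ (c * (1# - q ^ j)) (Near0.tends-^ near0-id (pred j)))))
    }

  -- D_q^k x^m = fallingProduct m k · x^{m−k}; the product vanishes for k > m, since
  -- its factor j = m is 1 − q⁰.
  fallingProduct : ℕ → ℕ → ℂ
  fallingProduct m zero    = 1#
  fallingProduct m (suc k) = fallingProduct m k * (1# - q ^ (m ∸ k))

  monomial-iterate : ℕ → ℕ → Function
  monomial-iterate m k = scaledMonomial (fallingProduct m k) (m ∸ k)

  monomial-iterate-IsDq : ∀ m k → IsDq q (monomial-iterate m k) (monomial-iterate m (suc k))
  -- The exponents `pred (m ∸ k)` and `m ∸ suc k` agree only propositionally; past k = m both are 0.
  monomial-iterate-IsDq m k = ≡.subst
    (λ j → IsDq q (monomial-iterate m k) (scaledMonomial (fallingProduct m (suc k)) j))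
    (ℕₚ.pred[m∸n]≡m∸[1+n] m k)
    (scaledMonomial-IsDq (fallingProduct m k) (m ∸ k))

  abstract
    -- No induction is involved: for k > m the last factor already has its exponent truncated to 0.
    fallingProduct-zero : ∀ {m k} → m ℕ.< k → fallingProduct m k ≈ 0#
    fallingProduct-zero {m} {suc k} (s≤s m≤k) = begin
      fallingProduct m k * (1# - q ^ (m ∸ k)) ≡⟨ ≡.cong (λ i → fallingProduct m k * (1# - q ^ i)) (ℕₚ.m≤n⇒m∸n≡0 m≤k) ⟩
      fallingProduct m k * (1# - 1#)          ≈⟨ *-congˡ (-‿inverseʳ 1#) ⟩
      fallingProduct m k * 0#                 ≈⟨ zeroʳ (fallingProduct m k) ⟩
      0#                                      ∎

    -- Each step moves the factor 1 - q^{m-k} from the Pochhammer symbol to the falling product and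
    -- leaves the total unchanged.
    fallingProduct-qPochhammer : ∀ {m k} → k ≤ m →
      fallingProduct m k * qPochhammer q q (m ∸ k) ≈ qPochhammer q q m
    fallingProduct-qPochhammer {m} {zero}  _   = *-identityˡ (qPochhammer q q m)
    fallingProduct-qPochhammer {m} {suc k} k<m = begin
      c * (1# - q ^ (m ∸ k)) * Q j              ≡⟨ ≡.cong (λ i → c * (1# - q ^ i) * Q j) m∸k≡1+j ⟩
      c * (1# - q * q ^ j) * Q j                ≈⟨ *-assoc c _ (Q j) ⟩
      c * ((1# - q * q ^ j) * Q j)              ≈⟨ *-congˡ factor ⟩
      c * Q (suc j)                             ≡⟨ ≡.cong (λ i → c * Q i) m∸k≡1+j ⟨
      c * Q (m ∸ k)                             ≈⟨ fallingProduct-qPochhammer (ℕₚ.<⇒≤ k<m) ⟩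
      Q m                                       ∎
      where
      j : ℕ
      j = m ∸ suc k
      c : ℂ
      c = fallingProduct m k
      Q : ℕ → ℂ
      Q = qPochhammer q q
      factor : (1# - q * q ^ j) * Q j ≈ Q (suc j)
      -- The Pochhammer factor is written with q^j · q, whereas the power q^{j+1} unfolds to q ·
      -- q^j.
      factor = trans (*-comm _ (Q j)) (*-congˡ (+-congˡ (-‿cong (*-comm q (q ^ j)))))
      m∸k≡1+j : m ∸ k ≡ suc j
      m∸k≡1+j = ℕₚ.+-∸-assoc 1 k<m

  -- The Heine series of a monomial: terms, sums and the limit in n.

  module _ (∣q∣<1 : ∣ q ∣< 1ℝ) where

    heineCoefficient : (a : ℂ) (k : ℕ) → ℂ
    heineCoefficient a k = a / qPochhammer q q k [ qPochhammer-nonzero q ∣q∣<1 k ]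

    heineTerm : (b : ℂ) (n m : ℕ) (x : ℂ) (k : ℕ) → ℂ
    heineTerm b n m x k =
      heineCoefficient (qPochhammer (q ^ n) q k) k * b ^ k * (monomial-iterate m k ⟨$⟩ x)

    hahnTerm : (α b : ℂ) (m : ℕ) (x : ℂ) (k : ℕ) → ℂ
    hahnTerm α b m x k = qBinomial q ∣q∣<1 m k * qPochhammer α q k * b ^ k * x ^ (m ∸ k)

    abstract
      -- By uniqueness of inverses 1/(q;q)_k is (q;q)_{m-k} times the reciprocal in the q-binomial
      -- coefficient; the falling product then absorbs (q;q)_{m-k} and becomes (q;q)_m.
      qBinomial-fallingProduct : ∀ {m k} → k ≤ m →
        fallingProduct m k * Complex.recip (qPochhammer q q k) (qPochhammer-nonzero q ∣q∣<1 k)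
          ≈ qBinomial q ∣q∣<1 m k
      qBinomial-fallingProduct {m} {k} k≤m = begin
        c * Complex.recip Qk (qPochhammer-nonzero q ∣q∣<1 k)
          ≈⟨ *-congˡ (recip-unique (qPochhammer-nonzero q ∣q∣<1 k) inverse) ⟨
        c * (r * Qj)   ≈⟨ *-congˡ (*-comm r Qj) ⟩
        c * (Qj * r)   ≈⟨ *-assoc c Qj r ⟨
        (c * Qj) * r   ≈⟨ *-congʳ (fallingProduct-qPochhammer k≤m) ⟩
        qPochhammer q q m * r ∎
        where
        c Qk Qj r : ℂ
        c  = fallingProduct m k
        Qk = qPochhammer q q k
        Qj = qPochhammer q q (m ∸ k)
        nz : Nonzero (Qk * Qj)
        nz = Complex.*-nonzero {Qk} (qPochhammer-nonzero q ∣q∣<1 k) (qPochhammer-nonzero q ∣q∣<1 (m ∸ k))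
        r  = Complex.recip (Qk * Qj) nz
        inverse : (r * Qj) * Qk ≈ 1#
        inverse = trans (*-assoc r Qj Qk) (trans (*-congˡ (*-comm Qj Qk)) (Complex.recip-inverseˡ (Qk * Qj) nz))

      heineTerm≈hahnTerm : ∀ {m k} → k ≤ m → ∀ b n x → heineTerm b n m x k ≈ hahnTerm (q ^ n) b m x k
      heineTerm≈hahnTerm {m} {k} k≤m b n x = trans
        (ℂ-Identities.coefficient-rearrange (qPochhammer (q ^ n) q k)
          (Complex.recip (qPochhammer q q k) (qPochhammer-nonzero q ∣q∣<1 k))
          (b ^ k) (fallingProduct m k) (x ^ (m ∸ k)))
        (*-congʳ (*-congʳ (*-congʳ (qBinomial-fallingProduct k≤m))))

      heineTerm-zero : ∀ {m k} → m ℕ.< k → ∀ b n x → heineTerm b n m x k ≈ 0#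
      heineTerm-zero {m} {k} m<k b n x = begin
        c * (fallingProduct m k * y) ≈⟨ *-congˡ (*-congʳ (fallingProduct-zero m<k)) ⟩
        c * (0# * y)                 ≈⟨ *-congˡ (zeroˡ y) ⟩
        c * 0#                       ≈⟨ zeroʳ c ⟩
        0#                           ∎
        where
        c y : ℂ
        c = heineCoefficient (qPochhammer (q ^ n) q k) k * b ^ k
        y = x ^ (m ∸ k)

      heineTerm-0-zero : ∀ k b m x → heineTerm b 0 m x (suc k) ≈ 0#
      heineTerm-0-zero k b m x = begin
        qPochhammer (q ^ 0) q (suc k) * i * p * y ≈⟨ *-congʳ (*-congʳ (*-congʳ (qPochhammer-1 q k))) ⟩
        0# * i * p * y                            ≈⟨ *-congʳ (*-congʳ (zeroˡ i)) ⟩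
        0# * p * y                                ≈⟨ *-congʳ (zeroˡ p) ⟩
        0# * y                                    ≈⟨ zeroˡ y ⟩
        0#                                        ∎
        where
        i p y : ℂ
        i = Complex.recip (qPochhammer q q (suc k)) (qPochhammer-nonzero q ∣q∣<1 (suc k))
        p = b ^ suc k
        y = monomial-iterate m (suc k) ⟨$⟩ x

      heineTerm-first : ∀ b m x → heineTerm b 0 m x 0 ≈ x ^ m
      heineTerm-first b m x = begin
        c * 1# * (1# * x ^ m) ≈⟨ *-cong (*-identityʳ c) (*-identityˡ (x ^ m)) ⟩
        c * x ^ m             ≈⟨ *-congʳ (1/1≈1 (qPochhammer-nonzero q ∣q∣<1 0)) ⟩
        1# * x ^ m            ≈⟨ *-identityˡ (x ^ m) ⟩
        x ^ m                 ∎
        where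
        c : ℂ
        c = heineCoefficient 1# 0

      heineTerm-hasSum : ∀ b n m x → HasSum (heineTerm b n m x) (hahn q ∣q∣<1 m (q ^ n) b x)
      heineTerm-hasSum b n m x =
        -- The cut is at `suc m`, since the terms 0 to m are all kept.
        finite-hasSum {heineTerm b n m x} {hahn q ∣q∣<1 m (q ^ n) b x} (suc m)
          (λ k m<k → heineTerm-zero m<k b n x)
          (sum-cong-≋ {suc m} {λ i → heineTerm b n m x (toℕ i)} {λ i → hahnTerm (q ^ n) b m x (toℕ i)}
            λ i → heineTerm≈hahnTerm (Finₚ.toℕ≤pred[n] i) b n x)

      -- With (1;q)_k = 0 for k ≥ 1 the series can be cut at 1, which yields x^m directly rather
      -- than through the Hahn sum.
      heineTerm-0-hasSum : ∀ b m x → HasSum (heineTerm b 0 m x) (x ^ m)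
      heineTerm-0-hasSum b m x = finite-hasSum {heineTerm b 0 m x} {x ^ m} 1
        (λ { (suc k) _ → heineTerm-0-zero k b m x })
        (trans (+-identityʳ (heineTerm b 0 m x 0)) (heineTerm-first b m x))

      hahnTerm-tends : ∀ b m x k → Seq.Tends (λ n → hahnTerm (q ^ n) b m x k)
        (qBinomial q ∣q∣<1 m k * b ^ k * x ^ (m ∸ k))
      hahnTerm-tends b m x k = Seq.tends-*ʳ (x ^ (m ∸ k)) {u = λ n → c * P n * b ^ k} {c * b ^ k}
        (Seq.tends-*ʳ (b ^ k) {u = λ n → c * P n} {c}
          -- Removes the factor 1 left behind by the limit of (q^n;q)_k.
          (Seq.tends-cong {u = λ n → c * P n} {λ n → c * P n} {c * 1#} {c} (λ _ → refl) (*-identityʳ c)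
            (Seq.tends-*ˡ c {P} {1#} (qPochhammer-tends-1 q ∣q∣<1 k))))
        where
        c : ℂ
        c = qBinomial q ∣q∣<1 m k
        P : ℕ → ℂ
        P n = qPochhammer (q ^ n) q k

      -- The sum has m + 1 terms for every n, so the limit may be taken term by term.
      hahn-converges : ∀ b m x →
        Converges (λ n → hahn q ∣q∣<1 m (q ^ n) b x) (rogersSzegő q ∣q∣<1 m b x)
      hahn-converges b m x = null⇒converges (λ n → hahn q ∣q∣<1 m (q ^ n) b x) (rogersSzegő q ∣q∣<1 m b x)
        (Seq.difference-null {λ n → hahn q ∣q∣<1 m (q ^ n) b x} {rogersSzegő q ∣q∣<1 m b x}
          (Seq.tends-sum {suc m} {λ n i → hahnTerm (q ^ n) b m x (toℕ i)}
            {λ i → qBinomial q ∣q∣<1 m (toℕ i) * b ^ toℕ i * x ^ (m ∸ toℕ i)}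
            λ i → hahnTerm-tends b m x (toℕ i)))

    -- Operator values for n = 0, for finite n and for n = ∞.

    heineOp-0 : ∀ b m → HeineOp q ∣q∣<1 b 0 (monomial m) (_^ m)
    heineOp-0 b m = record
      { iterate      = monomial-iterate m
      ; iterate-zero = λ x → *-identityˡ (x ^ m)
      ; iterate-suc  = monomial-iterate-IsDq m
      ; hasSum       = heineTerm-0-hasSum b m
      }

    heineOp-hahn : ∀ b m n → HeineOp q ∣q∣<1 b n (monomial m) (λ x → hahn q ∣q∣<1 m (q ^ n) b x)
    heineOp-hahn b m n = record
      { iterate      = monomial-iterate m
      ; iterate-zero = λ x → *-identityˡ (x ^ m)
      ; iterate-suc  = monomial-iterate-IsDq m
      ; hasSum       = heineTerm-hasSum b n m
      }

    heineOp-∞ : ∀ b m → HeineOp∞ q ∣q∣<1 b (monomial m) (λ x → rogersSzegő q ∣q∣<1 m b x)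
    heineOp-∞ b m = record
      -- The value at n = 0 is also taken in Hahn form, so that one formula covers the whole
      -- sequence.
      { value     = λ n x → hahn q ∣q∣<1 m (q ^ n) b x
      ; isHeineOp = heineOp-hahn b m
      ; converges = hahn-converges b m
      }

theorem1 : ∀ (q : ℂ) (∣q∣<1 : ∣ q ∣< 1ℝ) (b : ℂ) (m : ℕ) →
    HeineOp q ∣q∣<1 b 0 (monomial m) (λ x → x ^ m)
    × (∀ n → 1 ≤ n → HeineOp q ∣q∣<1 b n (monomial m) (λ x → hahn q ∣q∣<1 m (q ^ n) b x))
    × HeineOp∞ q ∣q∣<1 b (monomial m) (λ x → rogersSzegő q ∣q∣<1 m b x)
theorem1 q ∣q∣<1 b m =
    heineOp-0 q ∣q∣<1 b m
  , (λ n _ → heineOp-hahn q ∣q∣<1 b m n)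
  , heineOp-∞ q ∣q∣<1 b m
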